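{- There is no Pythagorean formally real field $F$ whose W-group $\mathcal G_F$ is the group (in the category $\mathcal C$) generated by five involutions $\sigma_1,\dots,\sigma_5$ subject to the relations $\sigma_i^2=1$ ($i=1,\dots,5$) and $(\sigma_1\sigma_2\sigma_3\sigma_4\sigma_5)^2=1$, with $\sigma_1,\dots,\sigma_5$ independent modulo $\Phi_F$.
   Context: All fields have characteristic $0$; Pythagorean: every sum of two squares is a square; formally real: $-1$ is not a sum of squares. $F^{(2)}=F(\sqrt a:a\in\dot F)$; $F^{(3)}$ is the compositum of all quadratic extensions $K$ of $F^{(2)}$ such that $K/F$ is Galois; the W-group is $\mathcal G_F=\mathrm{Gal}(F^{(3)}/F)$ and $\Phi_F$ is its Frattini subgroup. Elements are independent modulo $\Phi_F$ if their images in the $\mathbb F_2$-vector space $\mathcal G_F/\Phi_F$ are linearly independent. $\mathcal C$ is the category of pro-2-groups $G$ such that $g^4=1$ and $g^2$ is central for all $g\in G$. -}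

module Defs where

open import Algebra.Bundles using (CommutativeRing; Group; RawRing)
import Algebra.Definitions as AlgebraDefinitions
import Algebra.Definitions.RawMonoid as RawMonoidDefinitions
import Algebra.Morphism.Construct.Composition as Composition
import Algebra.Morphism.Construct.Identity as Identity
import Algebra.Morphism.RingMonomorphism as RingMonomorphism
open import Algebra.Morphism.Structures using (module RingMorphisms)
open import Data.Bool.Base using (Bool; false; if_then_else_)
open import Data.Fin.Base using (Fin)
open import Data.Fin.Patterns using (0F; 1F; 2F; 3F; 4F)
open import Data.List.Base using (List; []; _∷_; _++_; map; length)
open import Data.List.Relation.Unary.All using (All)
open import Data.Nat.Base as ℕ using (ℕ)
open import Data.Product.Base using (∃; _×_; _,_; proj₁; proj₂)
open import Data.Sum.Base using (_⊎_)
open import Function.Base using (_∘_; id)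
open import Level using (Level; 0ℓ; _⊔_; suc)
open import Relation.Binary.Bundles using (Poset)
open import Relation.Binary.PropositionalEquality.Core using (_≡_)
open import Relation.Nullary.Negation.Core using (¬_)
open import Relation.Unary using (Pred; _∈_; _∉_; _⊆_; _∪_)

module _ {c ℓ₁ ℓ₂ : Level} (P : Poset c ℓ₁ ℓ₂) where
  open Poset P

  IsChain : {p : Level} → Pred Carrier p → Set (c ⊔ ℓ₂ ⊔ p)
  IsChain C = ∀ {x y} → x ∈ C → y ∈ C → x ≤ y ⊎ y ≤ x

-- The empty chain is allowed, so the hypothesis forces P to be inhabited.
ZornsLemma : (c ℓ₁ ℓ₂ p : Level) → Set (suc (c ⊔ ℓ₁ ⊔ ℓ₂ ⊔ p))
ZornsLemma c ℓ₁ ℓ₂ p =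
  (P : Poset c ℓ₁ ℓ₂) → let open Poset P in
  ((C : Pred Carrier p) → IsChain P C → ∃ λ u → ∀ {x} → x ∈ C → x ≤ u) →
  ∃ λ m → ∀ {x} → m ≤ x → m ≈ x

-- Fields of classical algebra: no apartness relation is part of the
-- structure, in contrast to the library's Heyting fields.
record Field (c ℓ : Level) : Set (suc (c ⊔ ℓ)) where
  field
    commutativeRing : CommutativeRing c ℓ
  open CommutativeRing commutativeRing public
  open AlgebraDefinitions _≈_ using (Invertible)
  field
    1≉0        : 1# ≉ 0#
    invertible : ∀ {x} → x ≉ 0# → Invertible 1# _*_ x

module _ {c ℓ : Level} (F : Field c ℓ) where
  open Field F
  open RawMonoidDefinitions +-rawMonoid using (sum) renaming (_×_ to _·_)

  CharacteristicZero : Set ℓ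
  CharacteristicZero = (n : ℕ) → ℕ.suc n · 1# ≉ 0#

  FormallyReal : Set (c ⊔ ℓ)
  FormallyReal = (n : ℕ) (x : Fin n → Carrier) → sum (λ i → x i * x i) ≉ - 1#

  Pythagorean : Set (c ⊔ ℓ)
  Pythagorean = (x y : Carrier) → ∃ λ z → x * x + y * y ≈ z * z

  -- Polynomials are coefficient lists, constant term first.
  eval : List Carrier → Carrier → Carrier
  eval []       x = 0#
  eval (a ∷ as) x = a + x * eval as x

  -- The value of the formal derivative: (a + X g)′ = g + X g′.
  eval′ : List Carrier → Carrier → Carrier
  eval′ []       x = 0#
  eval′ (a ∷ as) x = eval as x + x * eval′ as x

  -- The monic polynomial of degree  length as  with lower coefficients as.
  monic : List Carrier → List Carrier
  monic as = as ++ 1# ∷ []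

  record Subfield (p : Level) : Set (c ⊔ ℓ ⊔ suc p) where
    field
      Member : Pred Carrier p
      resp   : ∀ {x y} → x ≈ y → Member x → Member y
      0∈     : Member 0#
      1∈     : Member 1#
      +∈     : ∀ {x y} → Member x → Member y → Member (x + y)
      *∈     : ∀ {x y} → Member x → Member y → Member (x * y)
      -∈     : ∀ {x} → Member x → Member (- x)
      ⁻¹∈    : ∀ {x y} → Member x → x * y ≈ 1# → Member y

    Element : Set (c ⊔ p)
    Element = ∃ Member

    rawSubring : RawRing (c ⊔ p) ℓ
    rawSubring = record
      { Carrier = Element
      ; _≈_     = λ x y → proj₁ x ≈ proj₁ y
      ; _+_     = λ (x , x∈) (y , y∈) → x + y , +∈ x∈ y∈
      ; _*_     = λ (x , x∈) (y , y∈) → x * y , *∈ x∈ y∈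
      ; -_      = λ (x , x∈) → - x , -∈ x∈
      ; 0#      = 0# , 0∈
      ; 1#      = 1# , 1∈
      }

    inclusion-isRingMonomorphism : RingMorphisms.IsRingMonomorphism rawSubring rawRing proj₁
    inclusion-isRingMonomorphism = record
      { isRingHomomorphism = record
        { isSemiringHomomorphism = record
          { isNearSemiringHomomorphism = record
            { +-isMonoidHomomorphism = record
              { isMagmaHomomorphism = record
                { isRelHomomorphism = record { cong = id }
                ; homo = λ _ _ → refl
                }
              ; ε-homo = refl
              }
            ; *-homo = λ _ _ → refl
            }
          ; 1#-homo = refl
          }
        ; -‿homo = λ _ → refl
        }
      ; injective = id
      }

    subring : CommutativeRing (c ⊔ p) ℓ
    subring = record
      { isCommutativeRing =
          RingMonomorphism.isCommutativeRing inclusion-isRingMonomorphism isCommutativeRing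
      }

  data Generated {s : Level} (S : Pred Carrier s) : Pred Carrier (c ⊔ ℓ ⊔ s) where
    gen  : ∀ {x} → x ∈ S → Generated S x
    resp : ∀ {x y} → x ≈ y → Generated S x → Generated S y
    0∈   : Generated S 0#
    1∈   : Generated S 1#
    +∈   : ∀ {x y} → Generated S x → Generated S y → Generated S (x + y)
    *∈   : ∀ {x y} → Generated S x → Generated S y → Generated S (x * y)
    -∈   : ∀ {x} → Generated S x → Generated S (- x)
    ⁻¹∈  : ∀ {x y} → Generated S x → x * y ≈ 1# → Generated S y

  subfieldGeneratedBy : {s : Level} → Pred Carrier s → Subfield (c ⊔ ℓ ⊔ s)
  subfieldGeneratedBy S = record
    { Member = Generated S
    ; resp = resp ; 0∈ = 0∈ ; 1∈ = 1∈ ; +∈ = +∈ ; *∈ = *∈ ; -∈ = -∈ ; ⁻¹∈ = ⁻¹∈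
    }

  module _ {p q : Level} (E : Subfield p) (K : Subfield q) where
    private
      module E = Subfield E
      module K = Subfield K

    record IsBasis {n : ℕ} (e : Fin n → Carrier) : Set (c ⊔ ℓ ⊔ p ⊔ q) where
      field
        members     : ∀ i → e i ∈ K.Member
        spanning    : ∀ {x} → x ∈ K.Member →
                      ∃ λ (a : Fin n → Carrier) → (∀ i → a i ∈ E.Member) × x ≈ sum (λ i → a i * e i)
        independent : (a : Fin n → Carrier) → (∀ i → a i ∈ E.Member) →
                      sum (λ i → a i * e i) ≈ 0# → ∀ i → a i ≈ 0#

    record IsExtensionOfDegree (n : ℕ) : Set (c ⊔ ℓ ⊔ p ⊔ q) where
      field
        contains : E.Member ⊆ K.Member
        basis    : Fin n → Carrier
        isBasis  : IsBasis basis

record AlgebraicClosure {c ℓ : Level} (F : Field c ℓ) (c′ ℓ′ : Level)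
                        : Set (c ⊔ ℓ ⊔ suc (c′ ⊔ ℓ′)) where
  private module F = Field F
  field
    Ω : Field c′ ℓ′
  open Field Ω
  field
    ι                    : F.Carrier → Carrier
    ι-isRingMonomorphism : RingMorphisms.IsRingMonomorphism F.rawRing rawRing ι
    algebraicallyClosed  : ∀ a as → ∃ λ x → eval Ω (monic Ω (a ∷ as)) x ≈ 0#
    algebraic            : ∀ x → ∃ λ as → eval Ω (map ι (monic F as)) x ≈ 0#

module _ {g ℓ : Level} (G : Group g ℓ) where
  open Group G
  open RawMonoidDefinitions rawMonoid using () renaming (sum to product)

  record IsSubgroup {h : Level} (H : Pred Carrier h) : Set (g ⊔ ℓ ⊔ h) where
    field
      resp-≈    : ∀ {x y} → x ≈ y → x ∈ H → y ∈ H
      ε-closed  : ε ∈ H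
      ∙-closed  : ∀ {x y} → x ∈ H → y ∈ H → x ∙ y ∈ H
      ⁻¹-closed : ∀ {x} → x ∈ H → x ⁻¹ ∈ H

  -- Linear independence over 𝔽₂ of the images of the x i in G / N, when this
  -- quotient is elementary abelian of exponent 2: coefficients are booleans,
  -- and a combination vanishes in G / N when a representative lies in N.
  IndependentModulo : {h : Level} {n : ℕ} → Pred Carrier h → (Fin n → Carrier) → Set h
  IndependentModulo {n = n} N x =
    (a : Fin n → Bool) → product (λ i → if a i then x i else ε) ∈ N → ∀ i → a i ≡ false

-- Extensions of F are subfields of a fixed algebraic closure Ω, and F is
-- identified with its image in Ω.
module GaloisTheory {c ℓ c′ ℓ′ : Level} {F : Field c ℓ} (closure : AlgebraicClosure F c′ ℓ′) where
  private module F = Field F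
  open AlgebraicClosure closure public
  open Field Ω

  levels : Level
  levels = c ⊔ ℓ ⊔ c′ ⊔ ℓ′

  Base : Pred Carrier (c ⊔ ℓ′)
  Base x = ∃ λ a → x ≈ ι a

  record IsMinimalPolynomial (as : List F.Carrier) (x : Carrier) : Set (c ⊔ ℓ′) where
    field
      root    : eval Ω (map ι (monic F as)) x ≈ 0#
      minimal : ∀ bs → eval Ω (map ι (monic F bs)) x ≈ 0# → length as ℕ.≤ length bs

  module _ {p : Level} (K : Subfield Ω p) where
    private
      module K = Subfield K
      module R = CommutativeRing K.subring

    record IsEmbedding (f : K.Element → Carrier) : Set (c ⊔ c′ ⊔ ℓ′ ⊔ p) where
      field
        isRingHomomorphism : RingMorphisms.IsRingHomomorphism K.rawSubring rawRing f
        fixes-base         : ∀ x → proj₁ x ∈ Base → f x ≈ proj₁ x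

    IsNormal : Set (c ⊔ c′ ⊔ ℓ′ ⊔ p)
    IsNormal = ∀ f → IsEmbedding f →
      (∀ x → f x ∈ K.Member) × (∀ {y} → y ∈ K.Member → ∃ λ x → f x ≈ y)

    -- Every element is a simple root of its minimal polynomial over F.
    IsSeparable : Set (c ⊔ c′ ⊔ ℓ′ ⊔ p)
    IsSeparable = ∀ {x} → x ∈ K.Member →
      ∃ λ as → IsMinimalPolynomial as x × eval′ Ω (map ι (monic F as)) x ≉ 0#

    -- Algebraicity over F is automatic inside Ω.
    record IsGalois : Set (c ⊔ c′ ⊔ ℓ′ ⊔ p) where
      field
        contains    : Base ⊆ K.Member
        isNormal    : IsNormal
        isSeparable : IsSeparable

    record Automorphism : Set (c ⊔ c′ ⊔ ℓ′ ⊔ p) where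
      field
        ⟦_⟧               : K.Element → K.Element
        isRingIsomorphism : RingMorphisms.IsRingIsomorphism K.rawSubring K.rawSubring ⟦_⟧
        fixes-base        : ∀ x → proj₁ x ∈ Base → ⟦ x ⟧ R.≈ x
      open RingMorphisms.IsRingIsomorphism isRingIsomorphism public

    open Automorphism using (⟦_⟧)

    private
      _∘ᴬ_ : Automorphism → Automorphism → Automorphism
      σ ∘ᴬ τ = record
        { ⟦_⟧               = ⟦ σ ⟧ ∘ ⟦ τ ⟧
        ; isRingIsomorphism = Composition.isRingIsomorphism trans
            (Automorphism.isRingIsomorphism τ) (Automorphism.isRingIsomorphism σ)
        ; fixes-base        = λ x x∈F → trans
            (Automorphism.⟦⟧-cong σ (Automorphism.fixes-base τ x x∈F))
            (Automorphism.fixes-base σ x x∈F)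
        }

      idᴬ : Automorphism
      idᴬ = record
        { ⟦_⟧               = id
        ; isRingIsomorphism = Identity.isRingIsomorphism K.rawSubring refl
        ; fixes-base        = λ _ _ → refl
        }

      module Inverse (σ : Automorphism) where
        open Automorphism σ using (⟦⟧-cong; +-homo; *-homo; -‿homo; 0#-homo; 1#-homo; injective; surjective; fixes-base)

        inv : K.Element → K.Element
        inv y = proj₁ (surjective y)

        rightInverse : ∀ y → ⟦ σ ⟧ (inv y) R.≈ y
        rightInverse y = proj₂ (surjective y) refl

        leftInverse : ∀ x → inv (⟦ σ ⟧ x) R.≈ x
        leftInverse x = injective (rightInverse (⟦ σ ⟧ x))

        inv-cong : ∀ {x y} → x R.≈ y → inv x R.≈ inv y
        inv-cong {x} {y} x≈y =
          injective (trans (rightInverse x) (trans x≈y (sym (rightInverse y))))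

        _⁻¹ᴬ : Automorphism
        _⁻¹ᴬ = record
          { ⟦_⟧               = inv
          ; isRingIsomorphism = record
            { isRingMonomorphism = record
              { isRingHomomorphism = record
                { isSemiringHomomorphism = record
                  { isNearSemiringHomomorphism = record
                    { +-isMonoidHomomorphism = record
                      { isMagmaHomomorphism = record
                        { isRelHomomorphism = record { cong = inv-cong }
                        ; homo = λ x y → injective (trans (rightInverse (x R.+ y))
                            (sym (trans (+-homo (inv x) (inv y))
                                        (+-cong (rightInverse x) (rightInverse y)))))
                        }
                      ; ε-homo = injective (trans (rightInverse R.0#) (sym 0#-homo))
                      }
                    ; *-homo = λ x y → injective (trans (rightInverse (x R.* y))
                        (sym (trans (*-homo (inv x) (inv y))
                                    (*-cong (rightInverse x) (rightInverse y)))))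
                    }
                  ; 1#-homo = injective (trans (rightInverse R.1#) (sym 1#-homo))
                  }
                ; -‿homo = λ x → injective (trans (rightInverse (R.- x))
                    (sym (trans (-‿homo (inv x)) (-‿cong (rightInverse x)))))
                }
              ; injective = λ {x} {y} e →
                  trans (sym (rightInverse x)) (trans (⟦⟧-cong e) (rightInverse y))
              }
            ; surjective = λ x → ⟦ σ ⟧ x , λ {y} e → trans (inv-cong {y} e) (leftInverse x)
            }
          ; fixes-base = λ x x∈F →
              injective (trans (rightInverse x) (sym (fixes-base x x∈F)))
          }

    Gal : Group (c ⊔ c′ ⊔ ℓ′ ⊔ p) (c′ ⊔ ℓ′ ⊔ p)
    Gal = record
      { Carrier = Automorphism
      ; _≈_     = λ σ τ → ∀ x → ⟦ σ ⟧ x R.≈ ⟦ τ ⟧ x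
      ; _∙_     = _∘ᴬ_
      ; ε       = idᴬ
      ; _⁻¹     = Inverse._⁻¹ᴬ
      ; isGroup = record
        { isMonoid = record
          { isSemigroup = record
            { isMagma = record
              { isEquivalence = record
                { refl  = λ _ → refl
                ; sym   = λ e x → sym (e x)
                ; trans = λ e e′ x → trans (e x) (e′ x)
                }
              ; ∙-cong = λ {σ} {_} {_} {τ′} e e′ x →
                  trans (Automorphism.⟦⟧-cong σ (e′ x)) (e (⟦ τ′ ⟧ x))
              }
            ; assoc = λ _ _ _ _ → refl
            }
          ; identity = (λ _ _ → refl) , (λ _ _ → refl)
          }
        ; inverse = (λ σ → Inverse.leftInverse σ) , (λ σ → Inverse.rightInverse σ)
        ; ⁻¹-cong = λ {σ} {τ} e x → Automorphism.injective σ
            (trans (Inverse.rightInverse σ x)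
                   (sym (trans (e (Inverse.inv τ x)) (Inverse.rightInverse τ x))))
        }
      }

    -- Open subgroups for the Krull topology: those containing the pointwise
    -- stabiliser of finitely many elements.
    IsOpen : {h : Level} → Pred Automorphism h → Set (c ⊔ c′ ⊔ ℓ′ ⊔ p ⊔ h)
    IsOpen H = ∃ λ xs → ∀ σ → All (λ x → ⟦ σ ⟧ x R.≈ x) xs → σ ∈ H

    -- Every subgroup containing an open subgroup is open, so H needs no
    -- openness hypothesis.
    record IsMaximalOpenSubgroup {h : Level} (M : Pred Automorphism h)
                                 : Set (c ⊔ c′ ⊔ ℓ′ ⊔ p ⊔ suc h) where
      field
        isSubgroup : IsSubgroup Gal M
        isOpen     : IsOpen M
        proper     : ∃ λ σ → σ ∉ M
        maximal    : (H : Pred Automorphism h) → IsSubgroup Gal H → M ⊆ H →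
                     (∀ σ → σ ∈ H) ⊎ H ⊆ M

    -- The Frattini subgroup of a profinite group: the intersection of its
    -- maximal open subgroups.
    Frattini : Pred Automorphism (suc (c ⊔ c′ ⊔ ℓ′ ⊔ p))
    Frattini σ = (M : Pred Automorphism (c ⊔ c′ ⊔ ℓ′ ⊔ p)) → IsMaximalOpenSubgroup M → σ ∈ M

  F⁽²⁾ : Subfield Ω levels
  F⁽²⁾ = subfieldGeneratedBy Ω (Base ∪ λ x → ∃ λ a → a F.≉ F.0# × x * x ≈ ι a)

  -- F⁽²⁾ is listed among the generators so that the compositum is F⁽²⁾ when
  -- there is no K to adjoin.
  F⁽³⁾ : Subfield Ω (suc levels)
  F⁽³⁾ = subfieldGeneratedBy Ω (Subfield.Member F⁽²⁾ ∪ λ x →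
    ∃ λ (K : Subfield Ω levels) →
      IsExtensionOfDegree Ω F⁽²⁾ K 2 × IsGalois K × x ∈ Subfield.Member K)

  W-group : Group (suc levels) (suc levels)
  W-group = Gal F⁽³⁾

  Φ : Pred (Group.Carrier W-group) (suc (suc levels))
  Φ = Frattini F⁽³⁾

infixl 7 _∙_
infix  8 _⁻¹

data Word (n : ℕ) : Set where
  gen : Fin n → Word n
  ε   : Word n
  _∙_ : Word n → Word n → Word n
  _⁻¹ : Word n → Word n

-- The group with finitely many generators and the given relators in the
-- category of pro-2-groups satisfying g⁴ = 1 and [g², h] = 1.  Finitely
-- generated abstract groups satisfying these laws are finite 2-groups, so no
-- completion is needed.
module Presentation {n : ℕ} (Relator : Pred (Word n) 0ℓ) where

  infix 4 _≈_

  data _≈_ : Word n → Word n → Set where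
    refl           : ∀ {u} → u ≈ u
    sym            : ∀ {u v} → u ≈ v → v ≈ u
    trans          : ∀ {u v w} → u ≈ v → v ≈ w → u ≈ w
    ∙-cong         : ∀ {u u′ v v′} → u ≈ u′ → v ≈ v′ → u ∙ v ≈ u′ ∙ v′
    ⁻¹-cong        : ∀ {u v} → u ≈ v → u ⁻¹ ≈ v ⁻¹
    assoc          : ∀ u v w → (u ∙ v) ∙ w ≈ u ∙ (v ∙ w)
    identityˡ      : ∀ u → ε ∙ u ≈ u
    identityʳ      : ∀ u → u ∙ ε ≈ u
    inverseˡ       : ∀ u → u ⁻¹ ∙ u ≈ ε
    inverseʳ       : ∀ u → u ∙ u ⁻¹ ≈ ε
    fourth-power   : ∀ u → u ∙ u ∙ u ∙ u ≈ ε
    square-central : ∀ u v → (u ∙ u) ∙ v ≈ v ∙ (u ∙ u)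
    relator        : ∀ {u} → u ∈ Relator → u ≈ ε

  group : Group 0ℓ 0ℓ
  group = record
    { Carrier = Word n
    ; _≈_     = _≈_
    ; _∙_     = _∙_
    ; ε       = ε
    ; _⁻¹     = _⁻¹
    ; isGroup = record
      { isMonoid = record
        { isSemigroup = record
          { isMagma = record
            { isEquivalence = record { refl = refl ; sym = sym ; trans = trans }
            ; ∙-cong = ∙-cong
            }
          ; assoc = assoc
          }
        ; identity = identityˡ , identityʳ
        }
      ; inverse = inverseˡ , inverseʳ
      ; ⁻¹-cong = ⁻¹-cong
      }
    }

σ : Fin 5 → Word 5
σ = gen

data Relator : Pred (Word 5) 0ℓ where
  involution : ∀ i → Relator (σ i ∙ σ i)
  product    : let w = σ 0F ∙ σ 1F ∙ σ 2F ∙ σ 3F ∙ σ 4F in Relator (w ∙ w)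

five-involution-group : Group 0ℓ 0ℓ
five-involution-group = Presentation.group Relator

{-# OPTIONS --safe #-}

-- Write aₖ for an element of F whose square root wₖ is moved by σₖ alone; only
-- F⁽³⁾ with its faithful group action and fixed field F enters.
--
-- (1) An involution τ of F⁽³⁾ defines an ordering: if α² + β² = γ² in F and τ
--     fixes α and β, it fixes γ, since η = √(γ(γ + α)) lies in F⁽³⁾ and
--     γ ↦ - γ would give τ order 4 on η.  It follows that each σₖ moves √-1.
-- (2) By Dedekind's independence of characters, every character of a suitable
--     subgroup has an eigenvector in F⁽³⁾.  Dihedral quotients of the group
--     thus give, for i, j, k distinct, a relation aⱼaₖ r² = x² - aᵢ z² over F.
--
-- Since √-1 w₀w₁w₂w₃w₄ is fixed, - a₀ and a₁a₂a₃a₄ differ by a square.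
-- Substituting the relation for a₃a₄ into the one for a₂a₃ yields
--     υ² = x² + a₁a₂ R² = a₂a₃ r² + a₂ S².
-- By (1), the first form shows that σ₀, σ₃, σ₄ and the involution σ₀σ₁σ₂σ₃σ₄
-- fix υ, and the second that σ₁ fixes υ and σ₂ negates it, so that υ = 0.  But
-- then w₃ r = ± √-1 S, where σ₀ fixes the left and negates the right hand side.

module Submission where

open import Defs
open import Algebra.Bundles using (CommutativeRing; Group)
import Algebra.Definitions
import Algebra.Definitions.RawMonoid as RawMonoidDefinitions
open import Algebra.Morphism.Structures using (module GroupMorphisms; module RingMorphisms)
import Algebra.Properties.AbelianGroup
import Algebra.Properties.Group
import Algebra.Properties.Ring
import Algebra.Properties.Semiring.Mult.TCOptimised
import Algebra.Solver.Ring
open import Algebra.Solver.Ring.AlmostCommutativeRing using (AlmostCommutativeRing; fromCommutativeRing; _-Raw-AlmostCommutative⟶_)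
open import Axiom.ExcludedMiddle using (ExcludedMiddle)
open import Data.Bool.Base using (Bool; true; false; T; _xor_; _∧_; _∨_; if_then_else_)
import Data.Bool.Properties as Bool
open import Data.Empty using (⊥; ⊥-elim)
open import Data.Fin.Base using (Fin)
open import Data.Fin.Patterns using (0F; 1F; 2F; 3F; 4F)
import Data.Fin.Properties as Fin
open import Data.Integer.Base as ℤ using (ℤ; +_; -[1+_])
import Data.Integer.Properties as ℤ
open import Data.List.Base using (List; []; _∷_; _++_; map; length)
open import Data.List.Relation.Unary.All as All using (All; []; _∷_)
import Data.List.Relation.Unary.All.Properties as All
open import Data.List.Relation.Unary.AllPairs as AllPairs using (AllPairs; []; _∷_)
import Data.List.Relation.Unary.AllPairs.Properties as AllPairs
open import Data.Maybe.Base as Maybe using (Maybe)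
open import Data.Nat.Base as ℕ using (ℕ)
import Data.Nat.Properties as ℕ
open import Data.Product.Base using (∃; _×_; _,_; proj₁; proj₂)
open import Data.Product.Properties using (≡-dec)
open import Data.Sign.Base as Sign using (Sign)
open import Data.Sum.Base using (_⊎_; inj₁; inj₂; [_,_]′)
open import Data.Unit.Base using (⊤; tt)
open import Function.Base using (_∘_)
open import Level using (Level; _⊔_; suc)
open import Relation.Binary.Bundles using (Poset)
open import Relation.Binary.Definitions using (DecidableEquality)
open import Relation.Binary.PropositionalEquality.Core as ≡ using (_≡_; _≢_)
import Relation.Binary.Reasoning.Setoid
open import Relation.Nullary.Decidable using (dec-true)
open import Relation.Nullary.Decidable.Core using (Dec; yes; no; does; ⌊_⌋; toWitness; fromWitness; from-yes; map′; dec⇒maybe; _×-dec_; _⊎-dec_; _→-dec_; ¬?)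
open import Relation.Nullary.Negation.Core using (¬_)

-- Ring solving with integer coefficients

-- An eigenvector is the image of some element under a product of factors 1 ± g in the group ring.
-- By independence of characters this product acts as a nonzero operator once the group elements in
-- its expansion are distinct. Homomorphisms to the dihedral group of order 8 are enough to tell
-- them apart, so no normal form for the presented group is required. A map with σᵢ ↦ s and every
-- other generator sent to 1 or t respects the relator exactly when the number of t's is even,
-- because st has order 4. This is the origin of the parity condition on `ψ`, and of the pairs j, k
-- in the norm relations. The other obstacle is that the fixed field of the W-group must be shown to
-- be F. Since F⁽³⁾ is reached from F by square roots, it suffices to extend embeddings along square
-- roots. Zorn's lemma is applied to partial embeddings that do not fix a chosen x₀ outside F.

module IntegerCoefficients {c ℓ : Level} (R : CommutativeRing c ℓ) where
  open CommutativeRing R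
  open Algebra.Properties.Ring ring
  open Algebra.Properties.AbelianGroup +-abelianGroup using (⁻¹-∙-comm)
  open Algebra.Properties.Semiring.Mult.TCOptimised semiring using (1+×; ×-homo-+; ×1-homo-*) renaming (_×_ to _·_)
  open Relation.Binary.Reasoning.Setoid setoid

  ⟦_⟧ℤ : ℤ → Carrier
  ⟦ + n      ⟧ℤ = n · 1#
  ⟦ -[1+ n ] ⟧ℤ = - (ℕ.suc n · 1#)

  ⊖-homo : ∀ m n → ⟦ m ℤ.⊖ n ⟧ℤ ≈ m · 1# - n · 1#
  ⊖-homo ℕ.zero    ℕ.zero    = sym (-‿inverseʳ 0#)
  ⊖-homo ℕ.zero    (ℕ.suc n) = sym (+-identityˡ _)
  ⊖-homo (ℕ.suc m) ℕ.zero    = sym (trans (+-congˡ -0#≈0#) (+-identityʳ _))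
  ⊖-homo (ℕ.suc m) (ℕ.suc n) = begin
    ⟦ ℕ.suc m ℤ.⊖ ℕ.suc n ⟧ℤ               ≡⟨ ≡.cong ⟦_⟧ℤ (ℤ.[1+m]⊖[1+n]≡m⊖n m n) ⟩
    ⟦ m ℤ.⊖ n ⟧ℤ                           ≈⟨ ⊖-homo m n ⟩
    m · 1# - n · 1#                        ≈⟨ +-congʳ (sym (trans (+-congʳ (-‿inverseʳ 1#)) (+-identityˡ _))) ⟩
    (1# - 1# + m · 1#) - n · 1#            ≈⟨ +-congʳ (trans (+-assoc _ _ _) (trans (+-congˡ (+-comm _ _)) (sym (+-assoc _ _ _)))) ⟩
    (1# + m · 1# - 1#) - n · 1#            ≈⟨ +-assoc _ _ _ ⟩
    1# + m · 1# + (- 1# - n · 1#)          ≈⟨ +-congˡ (⁻¹-∙-comm _ _) ⟩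
    (1# + m · 1#) - (1# + n · 1#)          ≈⟨ +-cong (sym (1+× m 1#)) (-‿cong (sym (1+× n 1#))) ⟩
    ℕ.suc m · 1# - ℕ.suc n · 1#            ∎

  ℤ-+-homo : ∀ i j → ⟦ i ℤ.+ j ⟧ℤ ≈ ⟦ i ⟧ℤ + ⟦ j ⟧ℤ
  ℤ-+-homo (+ m)    (+ n)    = ×-homo-+ 1# m n
  ℤ-+-homo (+ m)    -[1+ n ] = ⊖-homo m (ℕ.suc n)
  ℤ-+-homo -[1+ m ] (+ n)    = trans (⊖-homo n (ℕ.suc m)) (+-comm _ _)
  ℤ-+-homo -[1+ m ] -[1+ n ] = begin
    - (ℕ.suc (ℕ.suc (m ℕ.+ n)) · 1#)       ≡⟨ ≡.cong (λ k → - (k · 1#)) (≡.cong ℕ.suc (≡.sym (ℕ.+-suc m n))) ⟩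
    - ((ℕ.suc m ℕ.+ ℕ.suc n) · 1#)         ≈⟨ -‿cong (×-homo-+ 1# (ℕ.suc m) (ℕ.suc n)) ⟩
    - (ℕ.suc m · 1# + ℕ.suc n · 1#)        ≈⟨ ⁻¹-∙-comm _ _ ⟨
    - (ℕ.suc m · 1#) - ℕ.suc n · 1#        ∎

  ℤ-‿homo : ∀ i → ⟦ ℤ.- i ⟧ℤ ≈ - ⟦ i ⟧ℤ
  ℤ-‿homo (+ ℕ.zero)    = sym -0#≈0#
  ℤ-‿homo (+ ℕ.suc n)   = refl
  ℤ-‿homo -[1+ n ]      = sym (-‿involutive _)

  -◃-homo : ∀ n → ⟦ Sign.- ℤ.◃ n ⟧ℤ ≈ - (n · 1#)
  -◃-homo ℕ.zero    = sym -0#≈0#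
  -◃-homo (ℕ.suc n) = refl

  +◃-homo : ∀ n → ⟦ Sign.+ ℤ.◃ n ⟧ℤ ≈ n · 1#
  +◃-homo ℕ.zero    = refl
  +◃-homo (ℕ.suc n) = refl

  ℤ-*-homo : ∀ i j → ⟦ i ℤ.* j ⟧ℤ ≈ ⟦ i ⟧ℤ * ⟦ j ⟧ℤ
  ℤ-*-homo (+ m)    (+ n)    = trans (+◃-homo (m ℕ.* n)) (×1-homo-* m n)
  ℤ-*-homo (+ m)    -[1+ n ] = begin
    ⟦ Sign.- ℤ.◃ m ℕ.* ℕ.suc n ⟧ℤ          ≈⟨ -◃-homo (m ℕ.* ℕ.suc n) ⟩
    - ((m ℕ.* ℕ.suc n) · 1#)               ≈⟨ -‿cong (×1-homo-* m (ℕ.suc n)) ⟩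
    - (m · 1# * ℕ.suc n · 1#)              ≈⟨ -‿distribʳ-* _ _ ⟩
    m · 1# * - (ℕ.suc n · 1#)              ∎
  ℤ-*-homo -[1+ m ] (+ n)    = begin
    ⟦ Sign.- ℤ.◃ ℕ.suc m ℕ.* n ⟧ℤ          ≈⟨ -◃-homo (ℕ.suc m ℕ.* n) ⟩
    - ((ℕ.suc m ℕ.* n) · 1#)               ≈⟨ -‿cong (×1-homo-* (ℕ.suc m) n) ⟩
    - (ℕ.suc m · 1# * n · 1#)              ≈⟨ -‿distribˡ-* _ _ ⟩
    - (ℕ.suc m · 1#) * n · 1#              ∎
  ℤ-*-homo -[1+ m ] -[1+ n ] = begin
    (ℕ.suc m ℕ.* ℕ.suc n) · 1#             ≈⟨ ×1-homo-* (ℕ.suc m) (ℕ.suc n) ⟩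
    ℕ.suc m · 1# * ℕ.suc n · 1#            ≈⟨ -‿involutive _ ⟨
    - - (ℕ.suc m · 1# * ℕ.suc n · 1#)      ≈⟨ -‿cong (-‿distribˡ-* _ _) ⟩
    - (- (ℕ.suc m · 1#) * ℕ.suc n · 1#)    ≈⟨ -‿distribʳ-* _ _ ⟩
    - (ℕ.suc m · 1#) * - (ℕ.suc n · 1#)    ∎

  almostCommutativeRing : AlmostCommutativeRing c ℓ
  almostCommutativeRing = fromCommutativeRing R

  ℤ-homomorphism : ℤ.+-*-rawRing -Raw-AlmostCommutative⟶ almostCommutativeRing
  ℤ-homomorphism = record
    { ⟦_⟧    = ⟦_⟧ℤ
    ; +-homo = ℤ-+-homo
    ; *-homo = ℤ-*-homo
    ; -‿homo = ℤ-‿homo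
    ; 0-homo = refl
    ; 1-homo = refl
    }

  ≟-coefficients : ∀ i j → Maybe (⟦ i ⟧ℤ ≈ ⟦ j ⟧ℤ)
  ≟-coefficients i j = Maybe.map (λ i≡j → reflexive (≡.cong ⟦_⟧ℤ i≡j)) (dec⇒maybe (i ℤ.≟ j))

  open Algebra.Solver.Ring ℤ.+-*-rawRing almostCommutativeRing ℤ-homomorphism ≟-coefficients public
    using (Polynomial; con; solve; _:=_; _:+_; _:*_; _:-_; :-_)

-- Cancellation and signs of square roots in a field

module FieldProperties {c ℓ : Level} (K : Field c ℓ) (em : ∀ {a : Level} → ExcludedMiddle a) where
  open Field K
  open IntegerCoefficients commutativeRing public
  open Algebra.Properties.Ring ring public
    using (-0#≈0#; -‿involutive; -‿distribˡ-*; -‿distribʳ-*)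
  open Relation.Binary.Reasoning.Setoid setoid

  :0 :1 : ∀ {n} → Polynomial n
  :0 = con (+ 0)
  :1 = con (+ 1)

  inverse : ∀ {x} → x ≉ 0# → ∃ λ y → x * y ≈ 1#
  inverse x≉0 = proj₁ (invertible x≉0) , proj₂ (proj₂ (invertible x≉0))

  x-y≈0⇒x≈y : ∀ {x y} → x - y ≈ 0# → x ≈ y
  x-y≈0⇒x≈y {x} {y} e = begin
    x           ≈⟨ solve 2 (λ x y → x := (x :- y) :+ y) refl x y ⟩
    (x - y) + y ≈⟨ +-congʳ e ⟩
    0# + y      ≈⟨ +-identityˡ y ⟩
    y           ∎

  x≈y⇒x-y≈0 : ∀ {x y} → x ≈ y → x - y ≈ 0#
  x≈y⇒x-y≈0 {x} {y} e = trans (+-congʳ e) (-‿inverseʳ y)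

  x*y≈0⇒y≈0 : ∀ {x y} → x ≉ 0# → x * y ≈ 0# → y ≈ 0#
  x*y≈0⇒y≈0 {x} {y} x≉0 e = let (z , xz≈1) = inverse x≉0 in begin
    y           ≈⟨ *-identityˡ y ⟨
    1# * y      ≈⟨ *-congʳ xz≈1 ⟨
    x * z * y   ≈⟨ solve 3 (λ x y z → x :* z :* y := z :* (x :* y)) refl x y z ⟩
    z * (x * y) ≈⟨ *-congˡ e ⟩
    z * 0#      ≈⟨ zeroʳ z ⟩
    0#          ∎

  *-cancelˡ : ∀ {x y z} → x ≉ 0# → x * y ≈ x * z → y ≈ z
  *-cancelˡ {x} {y} {z} x≉0 e = x-y≈0⇒x≈y (x*y≈0⇒y≈0 x≉0 (begin
    x * (y - z)   ≈⟨ solve 3 (λ x y z → x :* (y :- z) := x :* y :- x :* z) refl x y z ⟩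
    x * y - x * z ≈⟨ x≈y⇒x-y≈0 e ⟩
    0#            ∎))

  x*y≈0⇒x≈0∨y≈0 : ∀ {x y} → x * y ≈ 0# → x ≈ 0# ⊎ y ≈ 0#
  x*y≈0⇒x≈0∨y≈0 {x} {y} e with em {P = x ≈ 0#}
  ... | yes x≈0 = inj₁ x≈0
  ... | no  x≉0 = inj₂ (x*y≈0⇒y≈0 x≉0 e)

  *-≉0 : ∀ {x y} → x ≉ 0# → y ≉ 0# → x * y ≉ 0#
  *-≉0 x≉0 y≉0 e = y≉0 (x*y≈0⇒y≈0 x≉0 e)

  x²≈0⇒x≈0 : ∀ {x} → x * x ≈ 0# → x ≈ 0#
  x²≈0⇒x≈0 e with x*y≈0⇒x≈0∨y≈0 e
  ... | inj₁ x≈0 = x≈0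
  ... | inj₂ x≈0 = x≈0

  x²≈y²⇒x≈±y : ∀ {x y} → x * x ≈ y * y → x ≈ y ⊎ x ≈ - y
  x²≈y²⇒x≈±y {x} {y} e with x*y≈0⇒x≈0∨y≈0 {x - y} {x + y} (begin
      (x - y) * (x + y) ≈⟨ solve 2 (λ x y → (x :- y) :* (x :+ y) := x :* x :- y :* y) refl x y ⟩
      x * x - y * y     ≈⟨ x≈y⇒x-y≈0 e ⟩
      0#                ∎)
  ... | inj₁ x-y≈0 = inj₁ (x-y≈0⇒x≈y x-y≈0)
  ... | inj₂ x+y≈0 = inj₂ (x-y≈0⇒x≈y (trans (+-congˡ (-‿involutive y)) x+y≈0))

  x≈-x⇒x≈0 : 1# + 1# ≉ 0# → ∀ {x} → x ≈ - x → x ≈ 0#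
  x≈-x⇒x≈0 2≉0 {x} e = x*y≈0⇒y≈0 2≉0 (begin
    (1# + 1#) * x ≈⟨ solve 1 (λ x → (:1 :+ :1) :* x := x :- (:- x)) refl x ⟩
    x - (- x)     ≈⟨ x≈y⇒x-y≈0 e ⟩
    0#            ∎)

-- Independent elements of the presented group

module W = Presentation Relator

-- The dihedral group of order 8, (a , b , z) standing for sᵃtᵇ(st)²ᶻ.
D₄ : Set
D₄ = Bool × Bool × Bool

infixl 7 _⊙_
-- The last summand is the central commutator (st)², which appears when t moves past s.
_⊙_ : D₄ → D₄ → D₄
(a , b , z) ⊙ (a′ , b′ , z′) = a xor a′ , b xor b′ , (z xor z′) xor (b ∧ a′)

1ᴰ sᴰ tᴰ : D₄
1ᴰ = false , false , false
sᴰ = true  , false , false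
tᴰ = false , true  , false

invᴰ : D₄ → D₄
invᴰ (a , b , z) = a , b , z xor (a ∧ b)

infix 4 _≟ᴰ_
_≟ᴰ_ : DecidableEquality D₄
_≟ᴰ_ = ≡-dec Bool._≟_ (≡-dec Bool._≟_ Bool._≟_)

-- Quantification over a finite type is decidable, so the laws of the group of order 8 hold by
-- evaluating every case.
∀Bool? : {P : Bool → Set} → (∀ b → Dec (P b)) → Dec (∀ b → P b)
∀Bool? P? = map′ (λ (pf , pt) → λ { false → pf ; true → pt }) (λ p → p false , p true)
                 (P? false ×-dec P? true)

∀D₄? : {P : D₄ → Set} → (∀ g → Dec (P g)) → Dec (∀ g → P g)
∀D₄? P? = map′ (λ p (a , b , z) → p a b z) (λ p a b z → p (a , b , z))
               (∀Bool? λ a → ∀Bool? λ b → ∀Bool? λ z → P? (a , b , z))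

⊙-assoc : ∀ g h k → (g ⊙ h) ⊙ k ≡ g ⊙ (h ⊙ k)
⊙-assoc = from-yes (∀D₄? λ g → ∀D₄? λ h → ∀D₄? λ k → (g ⊙ h) ⊙ k ≟ᴰ g ⊙ (h ⊙ k))

⊙-identityˡ : ∀ g → 1ᴰ ⊙ g ≡ g
⊙-identityˡ = from-yes (∀D₄? λ g → 1ᴰ ⊙ g ≟ᴰ g)

⊙-identityʳ : ∀ g → g ⊙ 1ᴰ ≡ g
⊙-identityʳ = from-yes (∀D₄? λ g → g ⊙ 1ᴰ ≟ᴰ g)

⊙-inverseˡ : ∀ g → invᴰ g ⊙ g ≡ 1ᴰ
⊙-inverseˡ = from-yes (∀D₄? λ g → invᴰ g ⊙ g ≟ᴰ 1ᴰ)

⊙-inverseʳ : ∀ g → g ⊙ invᴰ g ≡ 1ᴰ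
⊙-inverseʳ = from-yes (∀D₄? λ g → g ⊙ invᴰ g ≟ᴰ 1ᴰ)

⊙-fourth-power : ∀ g → g ⊙ g ⊙ g ⊙ g ≡ 1ᴰ
⊙-fourth-power = from-yes (∀D₄? λ g → g ⊙ g ⊙ g ⊙ g ≟ᴰ 1ᴰ)

⊙-square-central : ∀ g h → (g ⊙ g) ⊙ h ≡ h ⊙ (g ⊙ g)
⊙-square-central = from-yes (∀D₄? λ g → ∀D₄? λ h → (g ⊙ g) ⊙ h ≟ᴰ h ⊙ (g ⊙ g))

module _ (h : Fin 5 → D₄) where

  evalᴰ : Word 5 → D₄
  evalᴰ (gen i) = h i
  evalᴰ ε       = 1ᴰ
  evalᴰ (u ∙ v) = evalᴰ u ⊙ evalᴰ v
  evalᴰ (u ⁻¹)  = invᴰ (evalᴰ u)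

  RespectsRelators : Set
  RespectsRelators = (∀ i → h i ⊙ h i ≡ 1ᴰ) ×
    (let w = h 0F ⊙ h 1F ⊙ h 2F ⊙ h 3F ⊙ h 4F in w ⊙ w ≡ 1ᴰ)

  respectsRelators? : Dec RespectsRelators
  respectsRelators? = Fin.all? (λ i → h i ⊙ h i ≟ᴰ 1ᴰ) ×-dec (_ ≟ᴰ 1ᴰ)

  evalᴰ-cong : RespectsRelators → ∀ {u v} → u W.≈ v → evalᴰ u ≡ evalᴰ v
  evalᴰ-cong (invol , prod) = go
    where
    go : ∀ {u v} → u W.≈ v → evalᴰ u ≡ evalᴰ v
    go W.refl                     = ≡.refl
    go (W.sym e)                  = ≡.sym (go e)
    go (W.trans e e′)             = ≡.trans (go e) (go e′)
    go (W.∙-cong e e′)            = ≡.cong₂ _⊙_ (go e) (go e′)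
    go (W.⁻¹-cong e)              = ≡.cong invᴰ (go e)
    go (W.assoc u v w)            = ⊙-assoc (evalᴰ u) (evalᴰ v) (evalᴰ w)
    go (W.identityˡ u)            = ⊙-identityˡ (evalᴰ u)
    go (W.identityʳ u)            = ⊙-identityʳ (evalᴰ u)
    go (W.inverseˡ u)             = ⊙-inverseˡ (evalᴰ u)
    go (W.inverseʳ u)             = ⊙-inverseʳ (evalᴰ u)
    go (W.fourth-power u)         = ⊙-fourth-power (evalᴰ u)
    go (W.square-central u v)     = ⊙-square-central (evalᴰ u) (evalᴰ v)
    go (W.relator (involution i)) = invol i
    go (W.relator product)        = prod

-- A pair (b , g) is the signed group element (-1)ᵇ g.
Signed : Set
Signed = Bool × Word 5

-- The group ring product of the 1 + (-1)ᵇ g, expanded.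
terms : List Signed → List Signed
terms []            = (false , ε) ∷ []
terms ((b , g) ∷ l) = terms l ++ map (λ (b′ , w) → b xor b′ , g ∙ w) (terms l)

Kills : (Fin 5 → D₄) → Signed → Set
Kills h (_ , g) = evalᴰ h g ≡ 1ᴰ

-- A triangular condition: the homomorphism paired with an entry is nontrivial on it and trivial on
-- all later entries. Signs do not enter, so it can be decided while `ψ` is still a variable.
Detects : List (Fin 5 → D₄) → List Signed → Set
Detects (h ∷ hs) (g ∷ gs) = (RespectsRelators h × ¬ Kills h g × All (Kills h) gs) × Detects hs gs
Detects []       []       = ⊤
Detects _        _        = ⊥

Detects? : ∀ hs gs → Dec (Detects hs gs)
Detects? []       []       = yes tt
Detects? []       (_ ∷ _)  = no λ ()
Detects? (_ ∷ _)  []       = no λ ()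
Detects? (h ∷ hs) (g ∷ gs) =
  (respectsRelators? h ×-dec ¬? (evalᴰ h (proj₂ g) ≟ᴰ 1ᴰ) ×-dec All.all? (λ g′ → evalᴰ h (proj₂ g′) ≟ᴰ 1ᴰ) gs)
  ×-dec Detects? hs gs

Kills-terms : ∀ h l → All (Kills h) l → All (Kills h) (terms l)
Kills-terms h []            []       = ≡.refl ∷ []
Kills-terms h ((_ , g) ∷ l) (k ∷ ks) =
  All.++⁺ kt (All.map⁺ (All.map (λ k′ → ≡.cong₂ _⊙_ k k′) kt))
  where kt = Kills-terms h l ks

Distinct : Signed → Signed → Set
Distinct (_ , u) (_ , v) = ¬ u W.≈ v

∙-cancelˡ : ∀ g {u v} → g ∙ u W.≈ g ∙ v → u W.≈ v
∙-cancelˡ g {u} {v} e = Group∙.∙-cancelˡ g u v e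
  where module Group∙ = Algebra.Properties.Group W.group

-- Here `h` kills the first half of `terms` and sends every element of the second half to
-- `evalᴰ h g`, so it separates the halves. Within the second half, cancelling `g` reduces to the
-- first.
terms-distinct : ∀ hs l → Detects hs l → AllPairs Distinct (terms l)
terms-distinct []       []            _                        = [] ∷ []
terms-distinct (h ∷ hs) ((b , g) ∷ l) ((rel , g≢1 , ks) , det) =
  AllPairs.++⁺ ih (AllPairs.map⁺ (AllPairs.map (λ d e → d (∙-cancelˡ g e)) ih))
    (All.map (λ {u} ku → All.map⁺ (All.map (λ {v} kv u≈gv → g≢1 (≡.trans (≡.sym (⊙-identityʳ _))
        (≡.trans (≡.cong (evalᴰ h g ⊙_) (≡.sym kv)) (≡.trans (≡.sym (evalᴰ-cong h rel u≈gv)) ku)))) kt)) kt)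
  where
  ih = terms-distinct hs l det
  kt = Kills-terms h l ks

next : Fin 5 → Fin 5
next 0F = 1F
next 1F = 2F
next 2F = 3F
next 3F = 4F
next 4F = 0F

-- Between involutions this is the commutator: σᵢσⱼ = κᵢⱼ σⱼσᵢ.
κ : Fin 5 → Fin 5 → Word 5
κ i j = (gen i ∙ gen j) ∙ (gen i ∙ gen j)

-- Two generators go to t because the relator tolerates only an even number of them: a product of
-- one s and two t's in any order is a conjugate of s, hence an involution.
[_↦s,_,_↦t] : Fin 5 → Fin 5 → Fin 5 → Fin 5 → D₄
[ i ↦s, j , k ↦t] l =
  if does (l Fin.≟ i) then sᴰ else if does (l Fin.≟ j) ∨ does (l Fin.≟ k) then tᴰ else 1ᴰ

module Rotation (i : Fin 5) where
  v₁ v₂ v₃ v₄ : Fin 5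
  v₁ = next i
  v₂ = next v₁
  v₃ = next v₂
  v₄ = next v₃

module Generators (i : Fin 5) (ψ : Fin 5 → Bool) where
  open Rotation i

  -- The relator expresses the remaining commutator κ i v₁ by these.
  central : List Signed
  central = (ψ v₂ , κ i v₂) ∷ (ψ v₃ , κ i v₃) ∷ (ψ v₄ , κ i v₄)
          ∷ (false , κ v₃ v₄) ∷ (false , κ v₂ v₄) ∷ (false , κ v₁ v₄)
          ∷ (false , κ v₁ v₂) ∷ (false , κ v₂ v₃) ∷ (false , κ v₁ v₃) ∷ []

  -- The sign on σᵢ makes the outermost factor 1 - σᵢ, so a nonzero value of the product yields a
  -- vector that σᵢ moves. The 14 factors match the order 2¹⁴ of the group: five involutions modulo
  -- the centre and nine independent commutators.
  gens : List Signed
  gens = (true , gen i) ∷ (false , gen v₁) ∷ (false , gen v₂) ∷ (false , gen v₃) ∷ (false , gen v₄) ∷ central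

  -- As edges of K₅, consecutive members of  κ i v₁ ∷ central  are adjacent, and
  -- there is a homomorphism to D₄ that kills all commutators but these two.
  detectors : List (Fin 5 → D₄)
  detectors = ι i ∷ ι v₁ ∷ ι v₂ ∷ ι v₃ ∷ ι v₄
            ∷ [ i ↦s, v₂ , v₁ ↦t] ∷ [ i ↦s, v₃ , v₂ ↦t] ∷ [ i ↦s, v₄ , v₃ ↦t]
            ∷ [ v₄ ↦s, v₃ , i ↦t] ∷ [ v₄ ↦s, v₂ , v₃ ↦t] ∷ [ v₄ ↦s, v₁ , v₂ ↦t]
            ∷ [ v₁ ↦s, v₂ , v₄ ↦t] ∷ [ v₂ ↦s, v₃ , v₁ ↦t] ∷ [ v₃ ↦s, v₁ , v₂ ↦t] ∷ []
    where
    ι : Fin 5 → Fin 5 → D₄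
    -- The test for s comes first, so the repeated index sends σᵢ to s and every other generator to
    -- 1.
    ι i = [ i ↦s, i , i ↦t]

gens-detected : ∀ i ψ → Detects (Generators.detectors i ψ) (Generators.gens i ψ)
gens-detected 0F ψ = from-yes (Detects? (Generators.detectors 0F ψ) (Generators.gens 0F ψ))
gens-detected 1F ψ = from-yes (Detects? (Generators.detectors 1F ψ) (Generators.gens 1F ψ))
gens-detected 2F ψ = from-yes (Detects? (Generators.detectors 2F ψ) (Generators.gens 2F ψ))
gens-detected 3F ψ = from-yes (Detects? (Generators.detectors 3F ψ) (Generators.gens 3F ψ))
gens-detected 4F ψ = from-yes (Detects? (Generators.detectors 4F ψ) (Generators.gens 4F ψ))

-- Eigenvectors

-- What the argument uses of F⁽³⁾ and its W-group, F being the fixed field.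
record WField (c ℓ : Level) : Set (suc (c ⊔ ℓ)) where
  field
    K : Field c ℓ
  open Field K
  field
    2≉0                : 1# + 1# ≉ 0#
    act                : Word 5 → Carrier → Carrier
    isRingHomomorphism : ∀ u → RingMorphisms.IsRingHomomorphism rawRing rawRing (act u)
    act-≈              : ∀ {u v} → u W.≈ v → ∀ x → act u x ≈ act v x
    act-∙              : ∀ u v x → act (u ∙ v) x ≈ act u (act v x)
    act-ε              : ∀ x → act ε x ≈ x
    faithful           : ∀ u → (∀ x → act u x ≈ x) → u W.≈ ε

  Invariant : Carrier → Set ℓ
  Invariant x = ∀ u → act u x ≈ x

  field
    square-root : ∀ {x} → Invariant x → ∃ λ α → α * α ≈ x
    √[γ²+γα]    : ∀ {α β γ} → Invariant (α * α) → Invariant (γ * γ) → α * α + β * β ≈ γ * γ →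
                  ∃ λ η → η * η ≈ γ * (γ + α)

module Action {c ℓ : Level} (em : ∀ {a : Level} → ExcludedMiddle a) (L : WField c ℓ) where
  open WField L
  open Field K
  open FieldProperties K em
  open Relation.Binary.Reasoning.Setoid setoid
  module Act (u : Word 5) = RingMorphisms.IsRingHomomorphism (isRingHomomorphism u)

  act-cong : ∀ u {x y} → x ≈ y → act u x ≈ act u y
  act-cong u = Act.⟦⟧-cong u

  ev : (Signed → Carrier) → List Signed → Carrier → Carrier
  ev f []       x = 0#
  ev f (p ∷ ps) x = f p * act (proj₂ p) x + ev f ps x

  -- Evaluating at y x and subtracting `act u y` times the value at x removes the head and replaces
  -- each `f q` by `f′ y q`. By induction these vanish for all y; if `f q` were nonzero, q and the
  -- head would act alike, against faithfulness. Evaluation at 1 then disposes of the head.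
  dedekind : ∀ f ps → AllPairs Distinct ps → (∀ x → ev f ps x ≈ 0#) → All (λ p → f p ≈ 0#) ps
  dedekind f []       _        _ = []
  dedekind f (p ∷ ps) (d ∷ ds) h = fp≈0 ∷ rest
    where
    u = proj₂ p

    f′ : Carrier → Signed → Carrier
    f′ y q = f q * (act (proj₂ q) y - act u y)

    ev-f′ : ∀ y x qs → ev (f′ y) qs x ≈ ev f qs (y * x) - act u y * ev f qs x
    ev-f′ y x []       = solve 1 (λ u → :0 := :0 :- u :* :0) refl (act u y)
    ev-f′ y x (q ∷ qs) = begin
      f′ y q * act w x + ev (f′ y) qs x
        ≈⟨ +-congˡ (ev-f′ y x qs) ⟩
      f′ y q * act w x + (ev f qs (y * x) - act u y * ev f qs x)
        ≈⟨ solve 6 (λ fq wy uy wx e₁ e₂ → fq :* (wy :- uy) :* wx :+ (e₁ :- uy :* e₂)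
                      := (fq :* (wy :* wx) :+ e₁) :- uy :* (fq :* wx :+ e₂)) refl _ _ _ _ _ _ ⟩
      (f q * (act w y * act w x) + ev f qs (y * x)) - act u y * ev f (q ∷ qs) x
        ≈⟨ +-congʳ (+-congʳ (*-congˡ (sym (Act.*-homo w y x)))) ⟩
      ev f (q ∷ qs) (y * x) - act u y * ev f (q ∷ qs) x ∎
      where w = proj₂ q

    ev-f′≈0 : ∀ y x → ev (f′ y) ps x ≈ 0#
    ev-f′≈0 y x = begin
      ev (f′ y) ps x
        ≈⟨ ev-f′ y x ps ⟩
      ev f ps (y * x) - act u y * ev f ps x
        ≈⟨ solve 5 (λ fp uy ux e₁ e₂ → e₁ :- uy :* e₂
                      := (fp :* (uy :* ux) :+ e₁) :- uy :* (fp :* ux :+ e₂)) refl (f p) (act u y) (act u x) _ _ ⟩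
      (f p * (act u y * act u x) + ev f ps (y * x)) - act u y * ev f (p ∷ ps) x
        ≈⟨ +-cong (+-congʳ (*-congˡ (sym (Act.*-homo u y x)))) (-‿cong (*-congˡ (h x))) ⟩
      ev f (p ∷ ps) (y * x) - act u y * 0#
        ≈⟨ +-cong (h (y * x)) (trans (-‿cong (zeroʳ _)) -0#≈0#) ⟩
      0# + 0#
        ≈⟨ +-identityˡ 0# ⟩
      0# ∎

    rest : All (λ q → f q ≈ 0#) ps
    rest = All.tabulate λ {q} q∈ → vanish q (All.lookup d q∈) (λ y → All.lookup (dedekind (f′ y) ps ds (ev-f′≈0 y)) q∈)
      where
      vanish : ∀ q → Distinct p q → (∀ y → f′ y q ≈ 0#) → f q ≈ 0#
      vanish (b , w) u≉w e with em {P = f (b , w) ≈ 0#}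
      ... | yes fq≈0 = fq≈0
      ... | no  fq≉0 = ⊥-elim (u≉w (W.trans (W.sym (W.identityʳ u)) (W.trans (W.∙-cong W.refl (W.sym u⁻¹w≈ε))
              (W.trans (W.sym (W.assoc u (u ⁻¹) w)) (W.trans (W.∙-cong (W.inverseʳ u) W.refl) (W.identityˡ w))))))
        where
        u⁻¹w≈ε : u ⁻¹ ∙ w W.≈ ε
        u⁻¹w≈ε = faithful (u ⁻¹ ∙ w) λ x → begin
          act (u ⁻¹ ∙ w) x    ≈⟨ act-∙ _ _ x ⟩
          act (u ⁻¹) (act w x) ≈⟨ act-cong (u ⁻¹) (x-y≈0⇒x≈y (x*y≈0⇒y≈0 fq≉0 (e x))) ⟩
          act (u ⁻¹) (act u x) ≈⟨ act-∙ _ _ x ⟨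
          act (u ⁻¹ ∙ u) x    ≈⟨ act-≈ (W.inverseˡ u) x ⟩
          act ε x              ≈⟨ act-ε x ⟩
          x                    ∎

    ev-rest : ∀ qs → All (λ q → f q ≈ 0#) qs → ∀ x → ev f qs x ≈ 0#
    ev-rest []       []       x = refl
    ev-rest (q ∷ qs) (e ∷ es) x = trans (+-cong (trans (*-congʳ e) (zeroˡ _)) (ev-rest qs es x)) (+-identityˡ 0#)

    fp≈0 : f p ≈ 0#
    fp≈0 = begin
      f p                          ≈⟨ *-identityʳ (f p) ⟨
      f p * 1#                     ≈⟨ *-congˡ (Act.1#-homo u) ⟨
      f p * act u 1#               ≈⟨ +-identityʳ _ ⟨
      f p * act u 1# + 0#          ≈⟨ +-congˡ (ev-rest ps rest 1#) ⟨
      ev f (p ∷ ps) 1#             ≈⟨ h 1# ⟩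
      0#                           ∎

  sg : Bool → Carrier → Carrier
  sg false x = x
  sg true  x = - x

  sg-cong : ∀ b {x y} → x ≈ y → sg b x ≈ sg b y
  sg-cong false e = e
  sg-cong true  e = -‿cong e

  act-sg : ∀ u b x → act u (sg b x) ≈ sg b (act u x)
  act-sg u false x = refl
  act-sg u true  x = Act.-‿homo u x

  sg-xor : ∀ b b′ x → sg b (sg b′ x) ≈ sg (b xor b′) x
  sg-xor false b′    x = refl
  sg-xor true  false x = refl
  sg-xor true  true  x = -‿involutive x

  sg-involutive : ∀ b x → sg b (sg b x) ≈ x
  sg-involutive false x = refl
  sg-involutive true  x = -‿involutive x

  sg-comm : ∀ b b′ x → sg b (sg b′ x) ≈ sg b′ (sg b x)
  sg-comm false b′    x = refl
  sg-comm true  false x = refl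
  sg-comm true  true  x = refl

  sg-+ : ∀ b x y → sg b (x + y) ≈ sg b x + sg b y
  sg-+ false x y = refl
  sg-+ true  x y = solve 2 (λ x y → :- (x :+ y) := :- x :+ :- y) refl x y

  sg-1-* : ∀ b x → sg b 1# * x ≈ sg b x
  sg-1-* false x = *-identityˡ x
  sg-1-* true  x = solve 1 (λ x → :- :1 :* x := :- x) refl x

  -- If g acts as an involution, this is twice the projection onto its eigenspace for (-1)ᵇ.
  symmetrise : Signed → Carrier → Carrier
  symmetrise (b , g) y = y + sg b (act g y)

  op : List Signed → Carrier → Carrier
  op []      z = z
  op (p ∷ l) z = symmetrise p (op l z)

  coefficient : Signed → Carrier
  coefficient (b , _) = sg b 1#

  ev-++ : ∀ f ps qs x → ev f (ps ++ qs) x ≈ ev f ps x + ev f qs x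
  ev-++ f []       qs x = sym (+-identityˡ _)
  ev-++ f (p ∷ ps) qs x = trans (+-congˡ (ev-++ f ps qs x)) (sym (+-assoc _ _ _))

  -- Turns nested symmetrisations into one linear combination of group elements, the form to which
  -- `dedekind` applies.
  op≈ev : ∀ l z → op l z ≈ ev coefficient (terms l) z
  op≈ev []            z = sym (trans (+-identityʳ _) (trans (*-identityˡ _) (act-ε z)))
  op≈ev ((b , g) ∷ l) z = begin
    op l z + sg b (act g (op l z))
      ≈⟨ +-cong (op≈ev l z) (sg-cong b (act-cong g (op≈ev l z))) ⟩
    ev coefficient (terms l) z + sg b (act g (ev coefficient (terms l) z))
      ≈⟨ +-congˡ (go (terms l)) ⟨
    ev coefficient (terms l) z + ev coefficient (map _ (terms l)) z
      ≈⟨ ev-++ coefficient (terms l) _ z ⟨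
    ev coefficient (terms ((b , g) ∷ l)) z ∎
    where
    go : ∀ ps → ev coefficient (map (λ (b′ , w) → b xor b′ , g ∙ w) ps) z ≈ sg b (act g (ev coefficient ps z))
    go []              = sym (trans (sg-cong b (Act.0#-homo g)) (sg-0 b))
      where
      sg-0 : ∀ b → sg b 0# ≈ 0#
      sg-0 false = refl
      sg-0 true  = -0#≈0#
    go ((b′ , w) ∷ ps) = begin
      sg (b xor b′) 1# * act (g ∙ w) z + ev coefficient (map _ ps) z
        ≈⟨ +-cong (sg-1-* (b xor b′) _) (go ps) ⟩
      sg (b xor b′) (act (g ∙ w) z) + sg b (act g e)
        ≈⟨ +-congʳ (trans (sg-cong (b xor b′) (act-∙ g w z)) (sym (sg-xor b b′ _))) ⟩
      sg b (sg b′ (act g (act w z))) + sg b (act g e)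
        ≈⟨ +-congʳ (sg-cong b (trans (act-cong g (sg-1-* b′ _)) (act-sg g b′ _))) ⟨
      sg b (act g (sg b′ 1# * act w z)) + sg b (act g e)
        ≈⟨ sg-+ b _ _ ⟨
      sg b (act g (sg b′ 1# * act w z) + act g e)
        ≈⟨ sg-cong b (Act.+-homo g _ _) ⟨
      sg b (act g (ev coefficient ((b′ , w) ∷ ps) z)) ∎
      where e = ev coefficient ps z

  -- If the operator vanished everywhere, all coefficients in its expansion would be zero, among
  -- them the coefficient 1 of the empty product.
  op≉0 : ∀ hs l → Detects hs l → ∃ λ z → op l z ≉ 0#
  op≉0 hs l det with em {P = ∃ λ z → op l z ≉ 0#}
  ... | yes p = p
  ... | no ¬p = ⊥-elim (inhabited l (dedekind coefficient (terms l) (terms-distinct hs l det)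
                                     λ x → trans (sym (op≈ev l x)) (op≈0 x)))
    where
    op≈0 : ∀ x → op l x ≈ 0#
    op≈0 x with em {P = op l x ≈ 0#}
    ... | yes e = e
    ... | no ¬e = ⊥-elim (¬p (x , ¬e))

    inhabited : ∀ l → ¬ All (λ p → coefficient p ≈ 0#) (terms l)
    inhabited []      (e ∷ []) = 1≉0 e
    inhabited (p ∷ l) es       = inhabited l (All.++⁻ˡ (terms l) es)

  σ′ : Fin 5 → Carrier → Carrier
  σ′ i = act (gen i)

  Fixed : Carrier → Set ℓ
  Fixed x = ∀ i → σ′ i x ≈ x

  σ-cong : ∀ i {x y} → x ≈ y → σ′ i x ≈ σ′ i y
  σ-cong i = act-cong (gen i)

  σσ : ∀ i x → σ′ i (σ′ i x) ≈ x
  σσ i x = trans (sym (act-∙ _ _ x)) (trans (act-≈ (W.relator (involution i)) x) (act-ε x))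

  act-κ : ∀ i j x → act (κ i j) x ≈ σ′ i (σ′ j (σ′ i (σ′ j x)))
  act-κ i j x = trans (act-∙ _ _ x) (trans (act-∙ _ _ _) (σ-cong i (σ-cong j (act-∙ _ _ x))))

  κ-central : ∀ i j u x → act (κ i j) (act u x) ≈ act u (act (κ i j) x)
  κ-central i j u x = trans (sym (act-∙ _ _ x)) (trans (act-≈ (W.square-central _ u) x) (act-∙ _ _ x))

  κ-involutive : ∀ i j x → act (κ i j) (act (κ i j) x) ≈ x
  κ-involutive i j x = trans (sym (act-∙ _ _ x))
    (trans (act-≈ (W.trans (W.sym (W.assoc _ _ _)) (W.fourth-power _)) x) (act-ε x))

  relator-action : ∀ i₀ i₁ i₂ i₃ i₄ → Set (c ⊔ ℓ)
  relator-action i₀ i₁ i₂ i₃ i₄ = ∀ x →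
    σ′ i₀ (σ′ i₁ (σ′ i₂ (σ′ i₃ (σ′ i₄ (σ′ i₀ (σ′ i₁ (σ′ i₂ (σ′ i₃ (σ′ i₄ x))))))))) ≈ x

  -- Conjugation by the involution at the front carries the square of a word to the square of its
  -- cyclic shift.
  rotate : ∀ {i₀ i₁ i₂ i₃ i₄} → relator-action i₀ i₁ i₂ i₃ i₄ → relator-action i₁ i₂ i₃ i₄ i₀
  rotate {i₀} rel x = trans (sym (σσ i₀ _)) (trans (σ-cong i₀ (rel (σ′ i₀ x))) (σσ i₀ x))

  Π : Word 5
  Π = gen 0F ∙ gen 1F ∙ gen 2F ∙ gen 3F ∙ gen 4F

  act-Π : ∀ x → act Π x ≈ σ′ 0F (σ′ 1F (σ′ 2F (σ′ 3F (σ′ 4F x))))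
  act-Π x = trans (act-∙ _ _ x) (trans (act-∙ _ _ _) (trans (act-∙ _ _ _) (act-∙ _ _ _)))

  ΠΠ : ∀ x → act Π (act Π x) ≈ x
  ΠΠ x = trans (sym (act-∙ Π Π x)) (trans (act-≈ (W.relator product) x) (act-ε x))

  relator₀ : relator-action 0F 1F 2F 3F 4F
  relator₀ x = trans (sym (act-Π _)) (trans (act-cong Π (sym (act-Π x))) (ΠΠ x))

  rotated-relator : ∀ i → let open Rotation i in relator-action i v₁ v₂ v₃ v₄
  rotated-relator 0F = relator₀
  rotated-relator 1F = rotate relator₀
  rotated-relator 2F = rotate (rotate relator₀)
  rotated-relator 3F = rotate (rotate (rotate relator₀))
  rotated-relator 4F = rotate (rotate (rotate (rotate relator₀)))

  Eigen : Carrier → Signed → Set ℓ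
  Eigen y (b , g) = act g y ≈ sg b y

  CentralInvolution : Signed → Set (c ⊔ ℓ)
  CentralInvolution (_ , g) = (∀ x → act g (act g x) ≈ x) × (∀ u x → act g (act u x) ≈ act u (act g x))

  Eigen-symmetrise : ∀ p {y} → act (proj₂ p) (act (proj₂ p) y) ≈ y → Eigen (symmetrise p y) p
  Eigen-symmetrise (b , g) {y} invol = begin
    act g (y + sg b (act g y))            ≈⟨ Act.+-homo g _ _ ⟩
    act g y + act g (sg b (act g y))      ≈⟨ +-comm _ _ ⟩
    act g (sg b (act g y)) + act g y      ≈⟨ +-cong (trans (act-sg g b _) (sg-cong b invol)) (sym (sg-involutive b _)) ⟩
    sg b y + sg b (sg b (act g y))        ≈⟨ sg-+ b _ _ ⟨
    sg b (y + sg b (act g y))             ∎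

  symmetrise-Eigen : ∀ p q {y} → act (proj₂ q) (act (proj₂ p) y) ≈ act (proj₂ p) (act (proj₂ q) y) →
                     Eigen y q → Eigen (symmetrise p y) q
  symmetrise-Eigen (b , g) (b′ , h) {y} comm e = begin
    act h (y + sg b (act g y))            ≈⟨ Act.+-homo h _ _ ⟩
    act h y + act h (sg b (act g y))      ≈⟨ +-cong e (trans (act-sg h b _) (sg-cong b (trans comm (act-cong g e)))) ⟩
    sg b′ y + sg b (act g (sg b′ y))      ≈⟨ +-congˡ (trans (sg-cong b (act-sg g b′ y)) (sg-comm b b′ _)) ⟩
    sg b′ y + sg b′ (sg b (act g y))      ≈⟨ sg-+ b′ _ _ ⟨
    sg b′ (y + sg b (act g y))            ∎

  op-Eigen : ∀ l → All CentralInvolution l → ∀ z → All (Eigen (op l z)) l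
  op-Eigen []      []                     z = []
  op-Eigen (p ∷ l) ((inv , central) ∷ cs) z =
    Eigen-symmetrise p (inv _) ∷
    All.zipWith (λ {q} ((_ , cen) , e) → symmetrise-Eigen p q (cen (proj₂ p) _) e) (cs , op-Eigen l cs z)

  κ-CentralInvolution : ∀ b i j → CentralInvolution (b , κ i j)
  κ-CentralInvolution b i j = κ-involutive i j , κ-central i j

  κ-Eigen⇒comm : ∀ i j {y} → Eigen y (false , κ i j) → σ′ i (σ′ j y) ≈ σ′ j (σ′ i y)
  κ-Eigen⇒comm i j {y} e = begin
    σ′ i (σ′ j y)                                ≈⟨ σσ j _ ⟨
    σ′ j (σ′ j (σ′ i (σ′ j y)))                  ≈⟨ σ-cong j (σσ i _) ⟨
    σ′ j (σ′ i (σ′ i (σ′ j (σ′ i (σ′ j y)))))    ≈⟨ σ-cong j (σ-cong i (trans (sym (act-κ i j y)) e)) ⟩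
    σ′ j (σ′ i y)                                ∎

  κ-Eigen⇒Eigen : ∀ i j b {y} → Eigen y (b , κ i j) → σ′ j y ≈ y → σ′ j (σ′ i y) ≈ sg b (σ′ i y)
  κ-Eigen⇒Eigen i j b {y} e fix = begin
    σ′ j (σ′ i y)                         ≈⟨ σσ i _ ⟨
    σ′ i (σ′ i (σ′ j (σ′ i y)))           ≈⟨ σ-cong i (σ-cong i (σ-cong j (σ-cong i fix))) ⟨
    σ′ i (σ′ i (σ′ j (σ′ i (σ′ j y))))    ≈⟨ σ-cong i (trans (sym (act-κ i j y)) e) ⟩
    σ′ i (sg b y)                         ≈⟨ act-sg (gen i) b y ⟩
    sg b (σ′ i y)                         ∎

  rotation-covers : ∀ i j → let open Rotation i in j ≢ i → j ≡ v₁ ⊎ j ≡ v₂ ⊎ j ≡ v₃ ⊎ j ≡ v₄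
  rotation-covers = from-yes (Fin.all? λ i → Fin.all? λ j → let open Rotation i in
    ¬? (j Fin.≟ i) →-dec (j Fin.≟ v₁ ⊎-dec j Fin.≟ v₂ ⊎-dec j Fin.≟ v₃ ⊎-dec j Fin.≟ v₄))

  -- Eigenvectors with a prescribed character

  module _ (i : Fin 5) (ψ : Fin 5 → Bool) where
    open Rotation i
    open Generators i ψ

    central-involutions : All CentralInvolution central
    central-involutions = CI (ψ v₂) i v₂ ∷ CI (ψ v₃) i v₃ ∷ CI (ψ v₄) i v₄
                        ∷ CI false v₃ v₄ ∷ CI false v₂ v₄ ∷ CI false v₁ v₄ ∷ CI false v₁ v₂ ∷ CI false v₂ v₃ ∷ CI false v₁ v₃ ∷ []
      where CI = κ-CentralInvolution

    E : Carrier → Set ℓ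
    E y = All (Eigen y) central

    -- This models the plane representation of the dihedral group: σᵢ swaps y and σᵢ y, and each
    -- other generator acts diagonally with entries 1 and (-1) to the power `ψ j`.
    Eigenvector : Carrier → Set ℓ
    Eigenvector y = (∀ j → j ≢ i → σ′ j y ≈ y) × (∀ j → j ≢ i → σ′ j (σ′ i y) ≈ sg (ψ j) (σ′ i y)) × y - σ′ i y ≉ 0#

    symmetriser : Carrier → Carrier
    symmetriser y = symmetrise (false , gen v₁) (symmetrise (false , gen v₂)
                   (symmetrise (false , gen v₃) (symmetrise (false , gen v₄) y)))

    -- On `E` the commutators among v₁, ..., v₄ act trivially, so a later symmetrisation preserves
    -- what an earlier one fixed. The central commutators give the signs of σᵢ y at v₂, v₃, v₄. The
    -- commutator of i and v₁ is absent from `central`; the relator supplies the sign at v₁, and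
    -- parity makes it the prescribed one.
    symmetriser-Eigenvector : ψ v₁ ≡ (ψ v₂ xor ψ v₃) xor ψ v₄ → ∀ y₀ → E y₀ →
      symmetriser y₀ - σ′ i (symmetriser y₀) ≉ 0# → Eigenvector (symmetriser y₀)
    symmetriser-Eigenvector even y₀ E₀ nonzero = fixed , conjugate , nonzero
      where
      symmetrise-E : ∀ j {y} → E y → E (symmetrise (false , gen j) y)
      symmetrise-E j e = All.zipWith (λ {q} ((_ , cen) , eq) → symmetrise-Eigen (false , gen j) q (cen (gen j) _) eq)
                                     (central-involutions , e)

      y₁ y₂ y₃ y₄ : Carrier
      y₁ = symmetrise (false , gen v₄) y₀
      y₂ = symmetrise (false , gen v₃) y₁
      y₃ = symmetrise (false , gen v₂) y₂
      y₄ = symmetrise (false , gen v₁) y₃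

      E₁ = symmetrise-E v₄ E₀
      E₂ = symmetrise-E v₃ E₁
      E₃ = symmetrise-E v₂ E₂
      E₄ = symmetrise-E v₁ E₃

      keep : ∀ j k {y} → Eigen y (false , κ j k) → σ′ k y ≈ y → σ′ k (y + σ′ j y) ≈ y + σ′ j y
      keep j k e = symmetrise-Eigen (false , gen j) (false , gen k) (sym (κ-Eigen⇒comm j k e))

      new : ∀ j {y} → σ′ j (y + σ′ j y) ≈ y + σ′ j y
      new j = Eigen-symmetrise (false , gen j) (σσ j _)

      edge₃₄ : ∀ {y} → E y → Eigen y (false , κ v₃ v₄)
      edge₃₄ (_ ∷ _ ∷ _ ∷ e ∷ _) = e
      edge₂₄ : ∀ {y} → E y → Eigen y (false , κ v₂ v₄)
      edge₂₄ (_ ∷ _ ∷ _ ∷ _ ∷ e ∷ _) = e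
      edge₁₄ : ∀ {y} → E y → Eigen y (false , κ v₁ v₄)
      edge₁₄ (_ ∷ _ ∷ _ ∷ _ ∷ _ ∷ e ∷ _) = e
      edge₁₂ : ∀ {y} → E y → Eigen y (false , κ v₁ v₂)
      edge₁₂ (_ ∷ _ ∷ _ ∷ _ ∷ _ ∷ _ ∷ e ∷ _) = e
      edge₂₃ : ∀ {y} → E y → Eigen y (false , κ v₂ v₃)
      edge₂₃ (_ ∷ _ ∷ _ ∷ _ ∷ _ ∷ _ ∷ _ ∷ e ∷ _) = e
      edge₁₃ : ∀ {y} → E y → Eigen y (false , κ v₁ v₃)
      edge₁₃ (_ ∷ _ ∷ _ ∷ _ ∷ _ ∷ _ ∷ _ ∷ _ ∷ e ∷ _) = e

      fix₄ : σ′ v₄ y₄ ≈ y₄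
      fix₄ = keep v₁ v₄ (edge₁₄ E₃) (keep v₂ v₄ (edge₂₄ E₂) (keep v₃ v₄ (edge₃₄ E₁) (new v₄)))
      fix₃ : σ′ v₃ y₄ ≈ y₄
      fix₃ = keep v₁ v₃ (edge₁₃ E₃) (keep v₂ v₃ (edge₂₃ E₂) (new v₃))
      fix₂ : σ′ v₂ y₄ ≈ y₄
      fix₂ = keep v₁ v₂ (edge₁₂ E₃) (new v₂)
      fix₁ : σ′ v₁ y₄ ≈ y₄
      fix₁ = new v₁

      fixed : ∀ j → j ≢ i → σ′ j y₄ ≈ y₄
      fixed j j≢i with rotation-covers i j j≢i
      ... | inj₁ ≡.refl                      = fix₁
      ... | inj₂ (inj₁ ≡.refl)               = fix₂
      ... | inj₂ (inj₂ (inj₁ ≡.refl))        = fix₃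
      ... | inj₂ (inj₂ (inj₂ ≡.refl))        = fix₄

      x : Carrier
      x = σ′ i y₄

      conj₂ : σ′ v₂ x ≈ sg (ψ v₂) x
      conj₂ = κ-Eigen⇒Eigen i v₂ (ψ v₂) (All.head E₄) fix₂
      conj₃ : σ′ v₃ x ≈ sg (ψ v₃) x
      conj₃ = κ-Eigen⇒Eigen i v₃ (ψ v₃) (All.head (All.tail E₄)) fix₃
      conj₄ : σ′ v₄ x ≈ sg (ψ v₄) x
      conj₄ = κ-Eigen⇒Eigen i v₄ (ψ v₄) (All.head (All.tail (All.tail E₄))) fix₄

      -- All four generators fix `y₄`, so x is also the value at `y₄` of the whole word, and the
      -- square of that word acts trivially.
      conj₁₂₃₄ : σ′ v₁ (σ′ v₂ (σ′ v₃ (σ′ v₄ x))) ≈ x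
      conj₁₂₃₄ = begin
        σ′ v₁ (σ′ v₂ (σ′ v₃ (σ′ v₄ x)))                    ≈⟨ σσ i _ ⟨
        σ′ i (σ′ i (σ′ v₁ (σ′ v₂ (σ′ v₃ (σ′ v₄ x)))))      ≈⟨ σ-cong i (σ-cong i (σ-cong v₁ (σ-cong v₂ (σ-cong v₃ (σ-cong v₄ x≈))))) ⟩
        σ′ i (σ′ i (σ′ v₁ (σ′ v₂ (σ′ v₃ (σ′ v₄ (σ′ i (σ′ v₁ (σ′ v₂ (σ′ v₃ (σ′ v₄ y₄))))))))))
                                                           ≈⟨ σ-cong i (rotated-relator i y₄) ⟩
        x                                                  ∎
        where
        x≈ : x ≈ σ′ i (σ′ v₁ (σ′ v₂ (σ′ v₃ (σ′ v₄ y₄))))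
        x≈ = σ-cong i (sym (trans (σ-cong v₁ (trans (σ-cong v₂ (trans (σ-cong v₃ fix₄) fix₃)) fix₂)) fix₁))

      conj₂₃₄ : σ′ v₂ (σ′ v₃ (σ′ v₄ x)) ≈ sg ((ψ v₂ xor ψ v₃) xor ψ v₄) x
      conj₂₃₄ = begin
        σ′ v₂ (σ′ v₃ (σ′ v₄ x))                 ≈⟨ σ-cong v₂ (σ-cong v₃ conj₄) ⟩
        σ′ v₂ (σ′ v₃ (sg (ψ v₄) x))             ≈⟨ σ-cong v₂ (act-sg (gen v₃) (ψ v₄) x) ⟩
        σ′ v₂ (sg (ψ v₄) (σ′ v₃ x))             ≈⟨ σ-cong v₂ (sg-cong (ψ v₄) conj₃) ⟩
        σ′ v₂ (sg (ψ v₄) (sg (ψ v₃) x))         ≈⟨ trans (act-sg (gen v₂) (ψ v₄) _) (sg-cong (ψ v₄) (act-sg (gen v₂) (ψ v₃) x)) ⟩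
        sg (ψ v₄) (sg (ψ v₃) (σ′ v₂ x))         ≈⟨ sg-cong (ψ v₄) (sg-cong (ψ v₃) conj₂) ⟩
        sg (ψ v₄) (sg (ψ v₃) (sg (ψ v₂) x))     ≈⟨ sg-cong (ψ v₄) (trans (sg-comm (ψ v₃) (ψ v₂) x) (sg-xor (ψ v₂) (ψ v₃) x)) ⟩
        sg (ψ v₄) (sg (ψ v₂ xor ψ v₃) x)        ≈⟨ trans (sg-comm (ψ v₄) (ψ v₂ xor ψ v₃) x) (sg-xor (ψ v₂ xor ψ v₃) (ψ v₄) x) ⟩
        sg ((ψ v₂ xor ψ v₃) xor ψ v₄) x         ∎

      conj₁ : σ′ v₁ x ≈ sg (ψ v₁) x
      conj₁ = begin
        σ′ v₁ x                               ≈⟨ σ-cong v₁ conj₁₂₃₄ ⟨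
        σ′ v₁ (σ′ v₁ (σ′ v₂ (σ′ v₃ (σ′ v₄ x)))) ≈⟨ σσ v₁ _ ⟩
        σ′ v₂ (σ′ v₃ (σ′ v₄ x))               ≈⟨ conj₂₃₄ ⟩
        sg ((ψ v₂ xor ψ v₃) xor ψ v₄) x       ≡⟨ ≡.cong (λ b → sg b x) even ⟨
        sg (ψ v₁) x                           ∎

      conjugate : ∀ j → j ≢ i → σ′ j x ≈ sg (ψ j) x
      conjugate j j≢i with rotation-covers i j j≢i
      ... | inj₁ ≡.refl                      = conj₁
      ... | inj₂ (inj₁ ≡.refl)               = conj₂
      ... | inj₂ (inj₂ (inj₁ ≡.refl))        = conj₃
      ... | inj₂ (inj₂ (inj₂ ≡.refl))        = conj₄

    nonzero⇒eigenvector : ψ v₁ ≡ (ψ v₂ xor ψ v₃) xor ψ v₄ → (∃ λ z → op gens z ≉ 0#) → ∃ Eigenvector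
    -- For this vector y, `op gens z` is y - σᵢ y by definition, so the given inequality is the last
    -- component of `Eigenvector`.
    nonzero⇒eigenvector even (z , nonzero) = symmetriser (op central z) ,
      symmetriser-Eigenvector even (op central z) (op-Eigen central central-involutions z) nonzero

    abstract
      eigenvector : ψ v₁ ≡ (ψ v₂ xor ψ v₃) xor ψ v₄ → ∃ Eigenvector
      eigenvector even = nonzero⇒eigenvector even (op≉0 detectors gens (gens-detected i ψ))

-- Orderings and norm equations

module Impossible {c ℓ : Level} (em : ∀ {a : Level} → ExcludedMiddle a) (L : WField c ℓ) where
  open WField L
  open Field K
  open FieldProperties K em
  open Action em L
  open Relation.Binary.Reasoning.Setoid setoid

  HasSign : Fin 5 → Bool → Carrier → Set ℓ
  HasSign i b x = σ′ i x ≈ sg b x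

  sg-* : ∀ b b′ x y → sg b x * sg b′ y ≈ sg (b xor b′) (x * y)
  sg-* false false x y = refl
  sg-* false true  x y = sym (-‿distribʳ-* x y)
  sg-* true  false x y = sym (-‿distribˡ-* x y)
  sg-* true  true  x y = solve 2 (λ x y → :- x :* :- y := x :* y) refl x y

  HasSign-resp : ∀ i b {x y} → x ≈ y → HasSign i b x → HasSign i b y
  HasSign-resp i b x≈y e = trans (σ-cong i (sym x≈y)) (trans e (sg-cong b x≈y))

  HasSign-* : ∀ i b b′ {x y} → HasSign i b x → HasSign i b′ y → HasSign i (b xor b′) (x * y)
  HasSign-* i b b′ {x} {y} e e′ = trans (Act.*-homo (gen i) x y) (trans (*-cong e e′) (sg-* b b′ x y))

  HasSign-square : ∀ i b {x} → HasSign i b x → σ′ i (x * x) ≈ x * x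
  HasSign-square i b {x} e =
    ≡.subst (λ b → HasSign i b (x * x)) (Bool.xor-same b) (HasSign-* i b b e e)

  HasSign-inverse : ∀ i b {x y} → x * y ≈ 1# → HasSign i b x → HasSign i b y
  HasSign-inverse i b {x} {y} xy≈1 e = begin
    σ′ i y                ≈⟨ sg-involutive b _ ⟨
    sg b (sg b (σ′ i y))  ≈⟨ sg-cong b (*-cancelˡ x≉0 (begin
      x * sg b (σ′ i y)         ≈⟨ sg-* false b x _ ⟩
      sg b (x * σ′ i y)         ≈⟨ sg-cong b (*-congʳ (sg-involutive b x)) ⟨
      sg b (sg b (sg b x) * σ′ i y) ≈⟨ sg-cong b (*-congʳ (sg-cong b (sym e))) ⟩
      sg b (sg b (σ′ i x) * σ′ i y) ≈⟨ sg-cong b (trans (sg-* b false _ _) (reflexive (≡.cong (λ b → sg b _) (Bool.xor-identityʳ b)))) ⟩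
      sg b (sg b (σ′ i x * σ′ i y)) ≈⟨ sg-involutive b _ ⟩
      σ′ i x * σ′ i y           ≈⟨ Act.*-homo (gen i) x y ⟨
      σ′ i (x * y)              ≈⟨ trans (σ-cong i xy≈1) (Act.1#-homo (gen i)) ⟩
      1#                        ≈⟨ xy≈1 ⟨
      x * y                     ∎)) ⟩
    sg b y                ∎
    where
    x≉0 : x ≉ 0#
    x≉0 x≈0 = 1≉0 (trans (sym xy≈1) (trans (*-congʳ x≈0) (zeroˡ y)))

  Fixed-resp : ∀ {x y} → x ≈ y → Fixed x → Fixed y
  Fixed-resp e f i = HasSign-resp i false e (f i)

  Fixed-1 : Fixed 1#
  Fixed-1 i = Act.1#-homo (gen i)

  Fixed-+ : ∀ {x y} → Fixed x → Fixed y → Fixed (x + y)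
  Fixed-+ f g i = trans (Act.+-homo (gen i) _ _) (+-cong (f i) (g i))

  Fixed-* : ∀ {x y} → Fixed x → Fixed y → Fixed (x * y)
  Fixed-* f g i = HasSign-* i false false (f i) (g i)

  Fixed-neg : ∀ {x} → Fixed x → Fixed (- x)
  Fixed-neg f i = trans (Act.-‿homo (gen i) _) (-‿cong (f i))

  Fixed-square : ∀ {x} (b : Fin 5 → Bool) → (∀ i → HasSign i (b i) x) → Fixed (x * x)
  Fixed-square b h i = HasSign-square i (b i) (h i)

  Fixed-inverse : ∀ {x y} → x * y ≈ 1# → Fixed x → Fixed y
  Fixed-inverse e f i = HasSign-inverse i false e (f i)

  Fixed-act : ∀ u {x} → Fixed x → act u x ≈ x
  Fixed-act (gen i) f = f i
  Fixed-act ε       f = act-ε _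
  Fixed-act (u ∙ v) f = trans (act-∙ u v _) (trans (act-cong u (Fixed-act v f)) (Fixed-act u f))
  Fixed-act (u ⁻¹)  {x} f = begin
    act (u ⁻¹) x          ≈⟨ act-cong (u ⁻¹) (Fixed-act u f) ⟨
    act (u ⁻¹) (act u x)  ≈⟨ act-∙ _ _ x ⟨
    act (u ⁻¹ ∙ u) x      ≈⟨ act-≈ (W.inverseˡ u) x ⟩
    act ε x               ≈⟨ act-ε x ⟩
    x                     ∎

  √_ : ∀ {x} → Fixed x → ∃ λ α → α * α ≈ x
  √ f = square-root λ u → Fixed-act u f

  -- As γ² lies in F, only t γ = - γ has to be excluded. Then X = η · t η is fixed by t, while X = ±
  -- γβ is negated, so γβ = 0. This leaves the degenerate cases γ = 0 and γ = ± α, in which t fixes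
  -- γ after all.
  sum-of-squares-fixed : ∀ t → (∀ x → act t (act t x) ≈ x) → ∀ {α β γ} →
    Fixed (α * α) → Fixed (γ * γ) → α * α + β * β ≈ γ * γ → act t α ≈ α → act t β ≈ β → act t γ ≈ γ
  sum-of-squares-fixed t t²≈1 {α} {β} {γ} Fα² Fγ² eq tα tβ
    = [ (λ fixed → fixed) , negated⇒fixed ]′ (x²≈y²⇒x≈±y (trans (sym (Act.*-homo t γ γ)) (Fixed-act t Fγ²)))
    where
    module Negated (tγ≈-γ : act t γ ≈ - γ) where
      root = √[γ²+γα] (λ u → Fixed-act u Fα²) (λ u → Fixed-act u Fγ²) eq
      η = proj₁ root
      η² = proj₂ root
      X = η * act t η

      tη² : act t η * act t η ≈ γ * (γ - α)
      tη² = begin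
        act t η * act t η            ≈⟨ Act.*-homo t η η ⟨
        act t (η * η)                ≈⟨ act-cong t η² ⟩
        act t (γ * (γ + α))          ≈⟨ trans (Act.*-homo t _ _) (*-congˡ (Act.+-homo t γ α)) ⟩
        act t γ * (act t γ + act t α) ≈⟨ *-cong tγ≈-γ (+-cong tγ≈-γ tα) ⟩
        - γ * (- γ + α)              ≈⟨ solve 2 (λ γ α → :- γ :* (:- γ :+ α) := γ :* (γ :- α)) refl γ α ⟩
        γ * (γ - α)                  ∎

      X² : X * X ≈ (γ * β) * (γ * β)
      X² = begin
        X * X                               ≈⟨ solve 2 (λ x y → (x :* y) :* (x :* y) := (x :* x) :* (y :* y)) refl η (act t η) ⟩
        (η * η) * (act t η * act t η)       ≈⟨ *-cong η² tη² ⟩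
        γ * (γ + α) * (γ * (γ - α))         ≈⟨ solve 2 (λ γ α → γ :* (γ :+ α) :* (γ :* (γ :- α)) := γ :* γ :* (γ :* γ :- α :* α)) refl γ α ⟩
        γ * γ * (γ * γ - α * α)             ≈⟨ *-congˡ (+-congʳ eq) ⟨
        γ * γ * (α * α + β * β - α * α)     ≈⟨ solve 3 (λ γ α β → γ :* γ :* (α :* α :+ β :* β :- α :* α) := (γ :* β) :* (γ :* β)) refl γ α β ⟩
        (γ * β) * (γ * β)                   ∎

      tX : act t X ≈ X
      tX = trans (Act.*-homo t _ _) (trans (*-congˡ (t²≈1 η)) (*-comm _ _))

      tγβ : act t (γ * β) ≈ - (γ * β)
      tγβ = trans (Act.*-homo t γ β) (trans (*-cong tγ≈-γ tβ) (sym (-‿distribˡ-* γ β)))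

      γβ≈0 : γ * β ≈ 0#
      γβ≈0 = [ (λ X≈γβ → x≈-x⇒x≈0 2≉0 (trans (sym X≈γβ) (trans (sym tX) (trans (act-cong t X≈γβ) tγβ))))
             , (λ X≈-γβ → x≈-x⇒x≈0 2≉0 (sym (trans (sym X≈-γβ) (trans (sym tX) (trans (act-cong t X≈-γβ)
                            (trans (Act.-‿homo t _) (trans (-‿cong tγβ) (-‿involutive _))))))))
             ]′ (x²≈y²⇒x≈±y X²)

      β≈0⇒γ-fixed : β ≈ 0# → act t γ ≈ γ
      β≈0⇒γ-fixed β≈0 =
        [ (λ γ≈α → trans (act-cong t γ≈α) (trans tα (sym γ≈α)))
        , (λ γ≈-α → trans (act-cong t γ≈-α) (trans (Act.-‿homo t α) (trans (-‿cong tα) (sym γ≈-α))))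
        ]′ (x²≈y²⇒x≈±y (trans (sym eq) (trans (+-congˡ (trans (*-congˡ β≈0) (zeroʳ β))) (+-identityʳ _))))

    negated⇒fixed : act t γ ≈ - γ → act t γ ≈ γ
    negated⇒fixed tγ≈-γ =
      [ (λ γ≈0 → trans (trans (act-cong t γ≈0) (Act.0#-homo t)) (sym γ≈0)) , β≈0⇒γ-fixed ]′ (x*y≈0⇒x≈0∨y≈0 γβ≈0)
      where open Negated tγ≈-γ

  δ : Fin 5 → Fin 5 → Bool
  δ i j = does (j Fin.≟ i)

  -- For the trivial character the other generators fix both y and σᵢ y, so the difference of these
  -- two is moved by σᵢ alone.
  module Basis (i : Fin 5) where
    private
      v = eigenvector i (λ _ → false) ≡.refl
      y = proj₁ v

    abstract
      w : Carrier
      w = y - σ′ i y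

      w≉0 : w ≉ 0#
      w≉0 = proj₂ (proj₂ (proj₂ v))

      w-sign : ∀ j → HasSign j (δ i j) w
      w-sign j with j Fin.≟ i
      ... | yes ≡.refl = begin
        σ′ i (y - σ′ i y)           ≈⟨ trans (Act.+-homo (gen i) _ _) (+-congˡ (Act.-‿homo (gen i) _)) ⟩
        σ′ i y - σ′ i (σ′ i y)      ≈⟨ +-congˡ (-‿cong (σσ i y)) ⟩
        σ′ i y - y                  ≈⟨ solve 2 (λ x y → x :- y := :- (y :- x)) refl _ _ ⟩
        - (y - σ′ i y)              ∎
      ... | no j≢i = begin
        σ′ j (y - σ′ i y)           ≈⟨ trans (Act.+-homo (gen j) _ _) (+-congˡ (Act.-‿homo (gen j) _)) ⟩
        σ′ j y - σ′ j (σ′ i y)      ≈⟨ +-cong (proj₁ (proj₂ v) j j≢i) (-‿cong (proj₁ (proj₂ (proj₂ v)) j j≢i)) ⟩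
        y - σ′ i y                  ∎

  open Basis using (w; w≉0; w-sign)

  w²-Fixed : ∀ i → Fixed (w i * w i)
  w²-Fixed i = Fixed-square (δ i) (w-sign i)

  w-negated : ∀ i → σ′ i (w i) ≈ - w i
  w-negated i = ≡.subst (λ b → HasSign i b (w i)) (dec-true (i Fin.≟ i) ≡.refl) (w-sign i i)

  -- Multiplication by `w i` exchanges being negated and being fixed by σᵢ, which reduces the
  -- negative sign to the ordering property of σᵢ.
  sum-of-squares-sign : ∀ i b {α β γ} → Fixed (α * α) → Fixed (γ * γ) → α * α + β * β ≈ γ * γ →
    HasSign i b α → HasSign i b β → HasSign i b γ
  sum-of-squares-sign i false Fα² Fγ² eq sα sβ = sum-of-squares-fixed (gen i) (σσ i) Fα² Fγ² eq sα sβ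
  sum-of-squares-sign i true {α} {β} {γ} Fα² Fγ² eq sα sβ = begin
    σ′ i γ         ≈⟨ -‿involutive _ ⟨
    - - σ′ i γ     ≈⟨ -‿cong (*-cancelˡ (w≉0 i) (begin
      w i * - σ′ i γ       ≈⟨ solve 2 (λ w x → w :* :- x := :- w :* x) refl _ _ ⟩
      - w i * σ′ i γ       ≈⟨ *-congʳ (w-negated i) ⟨
      σ′ i (w i) * σ′ i γ  ≈⟨ Act.*-homo (gen i) _ _ ⟨
      σ′ i (w i * γ)       ≈⟨ sum-of-squares-fixed (gen i) (σσ i) (scaled Fα²) (scaled Fγ²) eq′
                                (HasSign-* i true true (w-negated i) sα) (HasSign-* i true true (w-negated i) sβ) ⟩
      w i * γ              ∎)) ⟩
    - γ            ∎
    where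
    :scaled = λ w x → (w :* x) :* (w :* x) := (w :* w) :* (x :* x)
    scaled : ∀ {x} → Fixed (x * x) → Fixed ((w i * x) * (w i * x))
    scaled {x} F = Fixed-resp (sym (solve 2 :scaled refl (w i) x)) (Fixed-* (w²-Fixed i) F)
    eq′ : (w i * α) * (w i * α) + (w i * β) * (w i * β) ≈ (w i * γ) * (w i * γ)
    eq′ = begin
      (w i * α) * (w i * α) + (w i * β) * (w i * β)
        ≈⟨ solve 3 (λ w α β → (w :* α) :* (w :* α) :+ (w :* β) :* (w :* β) := (w :* w) :* (α :* α :+ β :* β)) refl _ _ _ ⟩
      (w i * w i) * (α * α + β * β)     ≈⟨ *-congˡ eq ⟩
      (w i * w i) * (γ * γ)             ≈⟨ solve 2 :scaled refl (w i) γ ⟨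
      (w i * γ) * (w i * γ)             ∎

  square-Fixed⇒± : ∀ i {x} → Fixed (x * x) → σ′ i x ≈ x ⊎ σ′ i x ≈ - x
  square-Fixed⇒± i {x} F = x²≈y²⇒x≈±y (trans (sym (Act.*-homo (gen i) x x)) (F i))

  abstract
    ι : Carrier
    ι = proj₁ (√ Fixed-neg Fixed-1)

    ι² : ι * ι ≈ - 1#
    ι² = proj₂ (√ Fixed-neg Fixed-1)

  -- For γ² = w² + 1, use γ² + ι² = w² if γ is fixed, and (γw)² + (ιw²)² = w² if it is negated.
  ι-fixed⇒w-fixed : ∀ i γ → γ * γ ≈ w i * w i + 1# → σ′ i ι ≈ ι → σ′ i γ ≈ γ ⊎ σ′ i γ ≈ - γ → σ′ i (w i) ≈ w i
  ι-fixed⇒w-fixed i γ γ² ι-fixed (inj₁ γ-fixed) =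
    sum-of-squares-sign i false (Fixed-resp (sym γ²) (Fixed-+ (w²-Fixed i) Fixed-1)) (w²-Fixed i) (begin
      γ * γ + ι * ι          ≈⟨ +-cong γ² ι² ⟩
      w i * w i + 1# - 1#    ≈⟨ solve 1 (λ w → w :* w :+ :1 :- :1 := w :* w) refl (w i) ⟩
      w i * w i              ∎) γ-fixed ι-fixed
  ι-fixed⇒w-fixed i γ γ² ι-fixed (inj₂ γ-negated) =
    sum-of-squares-sign i false {γ * w i} {ι * (w i * w i)}
      (Fixed-resp (solve 2 (λ γ w → (γ :* γ) :* (w :* w) := (γ :* w) :* (γ :* w)) refl γ (w i))
                  (Fixed-* (Fixed-resp (sym γ²) (Fixed-+ (w²-Fixed i) Fixed-1)) (w²-Fixed i)))
      (w²-Fixed i) (begin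
      (γ * w i) * (γ * w i) + (ι * (w i * w i)) * (ι * (w i * w i))
        ≈⟨ solve 3 (λ γ w ι → (γ :* w) :* (γ :* w) :+ (ι :* (w :* w)) :* (ι :* (w :* w))
                              := (w :* w) :* (γ :* γ :+ (ι :* ι) :* (w :* w))) refl γ (w i) ι ⟩
      (w i * w i) * (γ * γ + (ι * ι) * (w i * w i))
        ≈⟨ *-congˡ (+-cong γ² (*-congʳ ι²)) ⟩
      (w i * w i) * (w i * w i + 1# + - 1# * (w i * w i))
        ≈⟨ solve 1 (λ w → (w :* w) :* (w :* w :+ :1 :+ :- :1 :* (w :* w)) := w :* w) refl (w i) ⟩
      w i * w i ∎)
      (HasSign-* i true true γ-negated (w-negated i))
      (HasSign-* i false false ι-fixed (w²-Fixed i i))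

  ι-negated : ∀ i → σ′ i ι ≈ - ι
  ι-negated i = [ (λ fixed → ⊥-elim (w≉0 i (x≈-x⇒x≈0 2≉0 (trans (sym (w-fixed fixed)) (w-negated i))))) , (λ neg → neg) ]′
                (square-Fixed⇒± i (Fixed-resp (sym ι²) (Fixed-neg Fixed-1)))
    where
    Fγ² = Fixed-+ (w²-Fixed i) Fixed-1
    w-fixed : σ′ i ι ≈ ι → σ′ i (w i) ≈ w i
    w-fixed fixed = let (γ , γ²) = √ Fγ² in
      ι-fixed⇒w-fixed i γ γ² fixed (square-Fixed⇒± i (Fixed-resp (sym γ²) Fγ²))

  -- Let y be the eigenvector and y′ = σᵢ y, and use (2yy′)² = (y² + y′²)² - (y² - y′²)². The sum y²
  -- + y′² is fixed by all generators. The difference is negated by σᵢ alone, so it is `w i` times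
  -- an element of F, and yy′ transforms by ψ, so it is `w j * w k` times one.
  norm-equation : ∀ i j k → let open Rotation i
                                ψ = λ l → δ j l xor δ k l in
    ψ i ≡ false → ψ v₁ ≡ (ψ v₂ xor ψ v₃) xor ψ v₄ →
    ∃ λ x → ∃ λ z → ∃ λ r → Fixed x × Fixed z × Fixed r × r ≉ 0# ×
      (w j * w k * r) * (w j * w k * r) ≈ x * x - (w i * z) * (w i * z)
  norm-equation i j k ψi≡false even = x , z , r , Fx , Fz , Fr , r≉0 , equation
    where
    ψ : Fin 5 → Bool
    ψ l = δ j l xor δ k l
    v = eigenvector i ψ even
    y = proj₁ v
    y′ = σ′ i y
    y-y′≉0 : y - y′ ≉ 0#
    y-y′≉0 = proj₂ (proj₂ (proj₂ v))
    y≉0 : y ≉ 0#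
    y≉0 y≈0 = y-y′≉0 (trans (+-cong y≈0 (-‿cong (trans (σ-cong i y≈0) (Act.0#-homo (gen i))))) (-‿inverseʳ 0#))
    y′≉0 : y′ ≉ 0#
    y′≉0 e = y≉0 (trans (sym (σσ i y)) (trans (σ-cong i e) (Act.0#-homo (gen i))))

    u = proj₁ (inverse (w≉0 i))
    wu≈1 : w i * u ≈ 1#
    wu≈1 = proj₂ (inverse (w≉0 i))
    u′ = proj₁ (inverse (*-≉0 (w≉0 j) (w≉0 k)))
    wwu′≈1 : w j * w k * u′ ≈ 1#
    wwu′≈1 = proj₂ (inverse (*-≉0 (w≉0 j) (w≉0 k)))

    x z r : Carrier
    x = y * y + y′ * y′
    z = (y * y - y′ * y′) * u
    r = (1# + 1#) * ((y * y′) * u′)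

    y²-move : σ′ i (y * y) ≈ y′ * y′
    y²-move = Act.*-homo (gen i) y y
    y′²-move : σ′ i (y′ * y′) ≈ y * y
    y′²-move = trans (Act.*-homo (gen i) y′ y′) (*-cong (σσ i y) (σσ i y))

    y-fixed : ∀ l → l ≢ i → σ′ l y ≈ y
    y-fixed = proj₁ (proj₂ v)
    y′-sign : ∀ l → l ≢ i → HasSign l (ψ l) y′
    y′-sign = proj₁ (proj₂ (proj₂ v))

    Fx : Fixed x
    Fx l with l Fin.≟ i
    ... | yes ≡.refl = trans (Act.+-homo (gen i) _ _) (trans (+-cong y²-move y′²-move) (+-comm _ _))
    ... | no l≢i = trans (Act.+-homo (gen l) _ _)
                         (+-cong (HasSign-square l false (y-fixed l l≢i)) (HasSign-square l (ψ l) (y′-sign l l≢i)))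

    Fz : Fixed z
    Fz l = ≡.subst (λ b → HasSign l b z) (Bool.xor-same (δ i l))
             (HasSign-* l (δ i l) (δ i l) difference (HasSign-inverse l (δ i l) wu≈1 (w-sign i l)))
      where
      difference : HasSign l (δ i l) (y * y - y′ * y′)
      difference with l Fin.≟ i
      ... | yes ≡.refl = begin
        σ′ i (y * y - y′ * y′)            ≈⟨ trans (Act.+-homo (gen i) _ _) (+-congˡ (Act.-‿homo (gen i) _)) ⟩
        σ′ i (y * y) - σ′ i (y′ * y′)     ≈⟨ +-cong y²-move (-‿cong y′²-move) ⟩
        y′ * y′ - y * y                   ≈⟨ solve 2 (λ a b → b :- a := :- (a :- b)) refl (y * y) (y′ * y′) ⟩
        - (y * y - y′ * y′)               ∎
      ... | no l≢i = trans (trans (Act.+-homo (gen l) _ _) (+-congˡ (Act.-‿homo (gen l) _)))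
          (+-cong (HasSign-square l false (y-fixed l l≢i)) (-‿cong (HasSign-square l (ψ l) (y′-sign l l≢i))))

    Fr : Fixed r
    Fr l = Fixed-* (Fixed-+ Fixed-1 Fixed-1) (λ l → ≡.subst (λ b → HasSign l b _) (Bool.xor-same (ψ l))
             (HasSign-* l (ψ l) (ψ l) (yy′-sign l)
               (HasSign-inverse l (ψ l) wwu′≈1 (HasSign-* l (δ j l) (δ k l) (w-sign j l) (w-sign k l))))) l
      where
      yy′-sign : ∀ l → HasSign l (ψ l) (y * y′)
      yy′-sign l with l Fin.≟ i
      ... | yes ≡.refl = ≡.subst (λ b → HasSign i b (y * y′)) (≡.sym ψi≡false)
                           (trans (Act.*-homo (gen i) y y′) (trans (*-congˡ (σσ i y)) (*-comm _ _)))
      ... | no l≢i = HasSign-* l false (ψ l) (y-fixed l l≢i) (y′-sign l l≢i)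

    r≉0 : r ≉ 0#
    r≉0 = *-≉0 2≉0 (*-≉0 (*-≉0 y≉0 y′≉0)
      λ u′≈0 → 1≉0 (trans (sym wwu′≈1) (trans (*-congˡ u′≈0) (zeroʳ _))))

    equation : (w j * w k * r) * (w j * w k * r) ≈ x * x - (w i * z) * (w i * z)
    equation = begin
      (w j * w k * r) * (w j * w k * r)
        ≈⟨ solve 4 (λ ww u y y′ → let r = (:1 :+ :1) :* ((y :* y′) :* u) in (ww :* r) :* (ww :* r)
                     := ((:1 :+ :1) :* (y :* y′) :* (ww :* u)) :* ((:1 :+ :1) :* (y :* y′) :* (ww :* u))) refl (w j * w k) u′ y y′ ⟩
      ((1# + 1#) * (y * y′) * (w j * w k * u′)) * ((1# + 1#) * (y * y′) * (w j * w k * u′))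
        ≈⟨ *-cong (*-congˡ wwu′≈1) (*-congˡ wwu′≈1) ⟩
      ((1# + 1#) * (y * y′) * 1#) * ((1# + 1#) * (y * y′) * 1#)
        ≈⟨ solve 2 (λ y y′ → ((:1 :+ :1) :* (y :* y′) :* :1) :* ((:1 :+ :1) :* (y :* y′) :* :1)
              := (y :* y :+ y′ :* y′) :* (y :* y :+ y′ :* y′)
                 :- ((y :* y :- y′ :* y′) :* :1) :* ((y :* y :- y′ :* y′) :* :1)) refl y y′ ⟩
      x * x - ((y * y - y′ * y′) * 1#) * ((y * y - y′ * y′) * 1#)
        ≈⟨ +-congˡ (-‿cong (*-cong (*-congˡ wu≈1) (*-congˡ wu≈1))) ⟨
      x * x - ((y * y - y′ * y′) * (w i * u)) * ((y * y - y′ * y′) * (w i * u))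
        ≈⟨ solve 4 (λ x d w u → x :* x :- (d :* (w :* u)) :* (d :* (w :* u)) := x :* x :- (w :* (d :* u)) :* (w :* (d :* u)))
             refl x (y * y - y′ * y′) (w i) u ⟩
      x * x - (w i * z) * (w i * z) ∎

  -- The contradiction from two norm equations

  HasSign-sg : ∀ i b b′ {x y} → HasSign i b x → y ≈ sg b′ x → σ′ i y ≈ sg (b′ xor b) x
  HasSign-sg i b b′ {x} e e′ = trans (σ-cong i e′) (trans (act-sg (gen i) b′ x) (trans (sg-cong b′ e) (sg-xor b′ b x)))

  Π-sign : (b : Fin 5 → Bool) → ∀ {x} → (∀ i → HasSign i (b i) x) →
    act Π x ≈ sg ((((b 4F xor b 3F) xor b 2F) xor b 1F) xor b 0F) x
  Π-sign b {x} h = trans (act-Π x)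
    (step 0F (((b 4F xor b 3F) xor b 2F) xor b 1F) (step 1F ((b 4F xor b 3F) xor b 2F)
    (step 2F (b 4F xor b 3F) (step 3F (b 4F) (h 4F)))))
    where
    step : ∀ i b′ {y} → y ≈ sg b′ x → σ′ i y ≈ sg (b′ xor b i) x
    step i b′ e = HasSign-sg i (b i) b′ (h i) e

  -- Exactly one of the five deltas is true at l, and it cancels the sign contributed by √-1.
  δ-product : ∀ l → true xor (δ 0F l xor ((δ 1F l xor δ 2F l) xor (δ 3F l xor δ 4F l))) ≡ false
  δ-product = from-yes (Fin.all? λ l →
    true xor (δ 0F l xor ((δ 1F l xor δ 2F l) xor (δ 3F l xor δ 4F l))) Bool.≟ false)

  w₁₂ w₃₄ p m : Carrier
  w₁₂ = w 1F * w 2F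
  w₃₄ = w 3F * w 4F
  p = w₁₂ * w₃₄
  m = ι * (w 0F * p)

  w₁₂-sign : ∀ l → HasSign l (δ 1F l xor δ 2F l) w₁₂
  w₁₂-sign l = HasSign-* l (δ 1F l) (δ 2F l) (w-sign 1F l) (w-sign 2F l)

  p-sign : ∀ l → HasSign l ((δ 1F l xor δ 2F l) xor (δ 3F l xor δ 4F l)) p
  p-sign l = HasSign-* l (δ 1F l xor δ 2F l) (δ 3F l xor δ 4F l) (w₁₂-sign l)
    (HasSign-* l (δ 3F l) (δ 4F l) (w-sign 3F l) (w-sign 4F l))

  Fm : Fixed m
  Fm l = ≡.subst (λ b → HasSign l b m) (δ-product l)
    (HasSign-* l true (δ 0F l xor ε-p) (ι-negated l) (HasSign-* l (δ 0F l) ε-p (w-sign 0F l) (p-sign l)))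
    where ε-p = (δ 1F l xor δ 2F l) xor (δ 3F l xor δ 4F l)

  p≉0 : p ≉ 0#
  p≉0 = *-≉0 (*-≉0 (w≉0 1F) (w≉0 2F)) (*-≉0 (w≉0 3F) (w≉0 4F))

  module Combine
    {x z r x′ z′ r′ : Carrier}
    (Fx : Fixed x) (Fz : Fixed z) (Fr : Fixed r) (r≉0 : r ≉ 0#)
    (norm : (w 2F * w 3F * r) * (w 2F * w 3F * r) ≈ x * x - (w 0F * z) * (w 0F * z))
    (Fx′ : Fixed x′) (Fz′ : Fixed z′) (Fr′ : Fixed r′) (r′≉0 : r′ ≉ 0#)
    (norm′ : (w 3F * w 4F * r′) * (w 3F * w 4F * r′) ≈ x′ * x′ - (w 1F * z′) * (w 1F * z′))
    {v : Carrier} (vinv : p * p * r′ * v ≈ 1#)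
    where
    t R S : Carrier
    -- Since v inverts p² r′ and m = √-1 w₀ p, the product p r′ t equals √-1 w₀ z, with square - a₀
    -- z². R and S are then read off from a₁a₂ t² (x′² - a₁ z′²) = a₁a₂ R² - a₂ S².
    t = z * m * v
    R = x′ * t
    S = w 1F * w 1F * z′ * t

    Ft : Fixed t
    Ft = Fixed-* (Fixed-* Fz Fm) (Fixed-inverse (vinv) (Fixed-* (Fixed-square (λ l → (δ 1F l xor δ 2F l) xor (δ 3F l xor δ 4F l)) p-sign) Fr′))
    FR : Fixed R
    FR = Fixed-* Fx′ Ft
    FS : Fixed S
    FS = Fixed-* (Fixed-* (w²-Fixed 1F) Fz′) Ft

    -- m ∈ F says that - a₀ and a₁a₂a₃a₄ differ by a square.
    transfer : - ((w 0F * z) * (w 0F * z)) ≈ (w₁₂ * (w₃₄ * r′) * t) * (w₁₂ * (w₃₄ * r′) * t)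
    transfer = sym (begin
      (w₁₂ * (w₃₄ * r′) * t) * (w₁₂ * (w₃₄ * r′) * t)
        ≈⟨ square-cong (solve 7 (λ ι w₀ a b z v r → a :* (b :* r) :* (z :* (ι :* (w₀ :* (a :* b))) :* v)
                                              := ι :* (w₀ :* z) :* ((a :* b) :* (a :* b) :* r :* v)) refl
             ι (w 0F) w₁₂ w₃₄ z v r′) ⟩
      (ι * (w 0F * z) * (p * p * r′ * v)) * (ι * (w 0F * z) * (p * p * r′ * v))
        ≈⟨ *-cong (*-congˡ (vinv)) (*-congˡ (vinv)) ⟩
      (ι * (w 0F * z) * 1#) * (ι * (w 0F * z) * 1#)
        ≈⟨ solve 2 (λ ι y → (ι :* y :* :1) :* (ι :* y :* :1) := (ι :* ι) :* (y :* y)) refl ι (w 0F * z) ⟩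
      (ι * ι) * ((w 0F * z) * (w 0F * z))
        ≈⟨ trans (*-congʳ ι²) (solve 1 (λ y → :- :1 :* y := :- y) refl _) ⟩
      - ((w 0F * z) * (w 0F * z)) ∎)
      where
      square-cong : ∀ {x y} → x ≈ y → x * x ≈ y * y
      square-cong e = *-cong e e

    two-sums : (w 2F * w 3F * r) * (w 2F * w 3F * r) + (w 2F * S) * (w 2F * S) ≈ x * x + (w₁₂ * R) * (w₁₂ * R)
    two-sums = begin
      (w 2F * w 3F * r) * (w 2F * w 3F * r) + (w 2F * S) * (w 2F * S)
        ≈⟨ +-congʳ (trans norm (+-congˡ transfer)) ⟩
      x * x + (w₁₂ * (w₃₄ * r′) * t) * (w₁₂ * (w₃₄ * r′) * t) + (w 2F * S) * (w 2F * S)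
        ≈⟨ +-congʳ (+-congˡ (solve 3 (λ a b t → (a :* b :* t) :* (a :* b :* t) := (a :* a) :* (t :* t) :* (b :* b)) refl w₁₂ (w₃₄ * r′) t)) ⟩
      x * x + w₁₂ * w₁₂ * (t * t) * ((w₃₄ * r′) * (w₃₄ * r′)) + (w 2F * S) * (w 2F * S)
        ≈⟨ +-congʳ (+-congˡ (*-congˡ norm′)) ⟩
      x * x + w₁₂ * w₁₂ * (t * t) * (x′ * x′ - (w 1F * z′) * (w 1F * z′)) + (w 2F * S) * (w 2F * S)
        ≈⟨ solve 6 (λ x w₁ w₂ t x′ z′ → let w₁₂ = w₁ :* w₂ ; S = w₁ :* w₁ :* z′ :* t in
             x :* x :+ w₁₂ :* w₁₂ :* (t :* t) :* (x′ :* x′ :- (w₁ :* z′) :* (w₁ :* z′)) :+ (w₂ :* S) :* (w₂ :* S)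
             := x :* x :+ (w₁₂ :* (x′ :* t)) :* (w₁₂ :* (x′ :* t))) refl x (w 1F) (w 2F) t x′ z′ ⟩
      x * x + (w₁₂ * R) * (w₁₂ * R) ∎

    w₁₂R-sign : ∀ l → HasSign l ((δ 1F l xor δ 2F l) xor false) (w₁₂ * R)
    w₁₂R-sign l = HasSign-* l (δ 1F l xor δ 2F l) false (w₁₂-sign l) (FR l)

    w₂₃r-sign : ∀ l → HasSign l ((δ 2F l xor δ 3F l) xor false) (w 2F * w 3F * r)
    w₂₃r-sign l = HasSign-* l (δ 2F l xor δ 3F l) false (HasSign-* l (δ 2F l) (δ 3F l) (w-sign 2F l) (w-sign 3F l)) (Fr l)

    w₂S-sign : ∀ l → HasSign l (δ 2F l xor false) (w 2F * S)
    w₂S-sign l = HasSign-* l (δ 2F l) false (w-sign 2F l) (FS l)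

    Fυ² : Fixed (x * x + (w₁₂ * R) * (w₁₂ * R))
    Fυ² = Fixed-+ (Fixed-* Fx Fx) (Fixed-square (λ l → (δ 1F l xor δ 2F l) xor false) w₁₂R-sign)

    module _ (υ : Carrier) (υ² : υ * υ ≈ x * x + (w₁₂ * R) * (w₁₂ * R)) where

      sign : ∀ l b → HasSign l b x → HasSign l b (w₁₂ * R) → HasSign l b υ
      sign l b = sum-of-squares-sign l b (Fixed-* Fx Fx) (Fixed-resp (sym υ²) Fυ²) (sym υ²)

      sign′ : ∀ l b → HasSign l b (w 2F * w 3F * r) → HasSign l b (w 2F * S) → HasSign l b υ
      sign′ l b = sum-of-squares-sign l b (Fixed-square (λ l → (δ 2F l xor δ 3F l) xor false) w₂₃r-sign) (Fixed-resp (sym υ²) Fυ²) (trans two-sums (sym υ²))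

      υ-sign : ∀ l → HasSign l (δ 2F l) υ
      υ-sign 0F = sign 0F false (Fx 0F) (w₁₂R-sign 0F)
      υ-sign 1F = sign′ 1F false (w₂₃r-sign 1F) (w₂S-sign 1F)
      υ-sign 2F = sign′ 2F true (w₂₃r-sign 2F) (w₂S-sign 2F)
      υ-sign 3F = sign 3F false (Fx 3F) (w₁₂R-sign 3F)
      υ-sign 4F = sign 4F false (Fx 4F) (w₁₂R-sign 4F)

      -- The word `Π` changes the sign of `w₁₂ * R` twice, through σ₁ and σ₂, hence fixes it, and
      -- being an involution it must fix υ. But of its five letters only σ₂ negates υ.
      υ≈0 : υ ≈ 0#
      υ≈0 = x≈-x⇒x≈0 2≉0 (trans
        (sym (sum-of-squares-fixed Π ΠΠ (Fixed-* Fx Fx) (Fixed-resp (sym υ²) Fυ²) (sym υ²)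
               (Fixed-act Π Fx) (Π-sign (λ l → (δ 1F l xor δ 2F l) xor false) w₁₂R-sign)))
        (Π-sign (δ 2F) υ-sign))

      A B : Carrier
      A = w 3F * r
      B = ι * S

      A²≈B² : A * A ≈ B * B
      A²≈B² = x-y≈0⇒x≈y (x*y≈0⇒y≈0 (*-≉0 (w≉0 2F) (w≉0 2F)) (begin
        (w 2F * w 2F) * (A * A - B * B)
          ≈⟨ solve 5 (λ w₂ w₃ r ι S → (w₂ :* w₂) :* ((w₃ :* r) :* (w₃ :* r) :- (ι :* S) :* (ι :* S))
                := (w₂ :* w₃ :* r) :* (w₂ :* w₃ :* r) :- (ι :* ι) :* ((w₂ :* S) :* (w₂ :* S))) refl (w 2F) (w 3F) r ι S ⟩
        (w 2F * w 3F * r) * (w 2F * w 3F * r) - (ι * ι) * ((w 2F * S) * (w 2F * S))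
          ≈⟨ +-congˡ (trans (-‿cong (*-congʳ ι²)) (solve 1 (λ y → :- (:- :1 :* y) := y) refl _)) ⟩
        (w 2F * w 3F * r) * (w 2F * w 3F * r) + (w 2F * S) * (w 2F * S)
          ≈⟨ trans two-sums (sym υ²) ⟩
        υ * υ
          ≈⟨ trans (*-congʳ υ≈0) (zeroˡ υ) ⟩
        0# ∎))

      A-fixed : σ′ 0F A ≈ A
      A-fixed = HasSign-* 0F false false (w-sign 3F 0F) (Fr 0F)

      B-negated : σ′ 0F B ≈ - B
      B-negated = HasSign-* 0F true false (ι-negated 0F) (FS 0F)

      A≈-A : A ≈ - A
      A≈-A = [ (λ A≈B → trans (sym A-fixed) (trans (σ-cong 0F A≈B) (trans B-negated (-‿cong (sym A≈B)))))
             , (λ A≈-B → trans (sym A-fixed) (trans (σ-cong 0F A≈-B) (trans (Act.-‿homo (gen 0F) B)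
                          (-‿cong (trans B-negated (sym A≈-B))))))
             ]′ (x²≈y²⇒x≈±y A²≈B²)

      absurd : ⊥
      absurd = *-≉0 (w≉0 3F) r≉0 (x≈-x⇒x≈0 2≉0 A≈-A)

  impossible : ⊥
  impossible =
    let (x , z , r , Fx , Fz , Fr , r≉0 , norm) = norm-equation 0F 2F 3F ≡.refl ≡.refl
        (x′ , z′ , r′ , Fx′ , Fz′ , Fr′ , r′≉0 , norm′) = norm-equation 1F 3F 4F ≡.refl ≡.refl
        (v , vinv) = inverse (*-≉0 (*-≉0 p≉0 p≉0) r′≉0)
        open Combine Fx Fz Fr r≉0 norm Fx′ Fz′ Fr′ r′≉0 norm′ vinv
        (υ , υ²) = √ Fυ²
    in absurd υ υ²

-- Separability

module Closure {c ℓ c′ ℓ′ : Level} (em : ∀ {a : Level} → ExcludedMiddle a)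
               {F : Field c ℓ} (char0 : CharacteristicZero F) (closure : AlgebraicClosure F c′ ℓ′) where
  open GaloisTheory closure
  open Field Ω
  open FieldProperties Ω em
  open Relation.Binary.Reasoning.Setoid setoid
  open RingMorphisms.IsRingMonomorphism ι-isRingMonomorphism public
    using () renaming (⟦⟧-cong to ι-cong; +-homo to ι-+; *-homo to ι-*; 0#-homo to ι-0; 1#-homo to ι-1;
                       -‿homo to ι-neg; injective to ι-injective)
  module F = Field F
  open RawMonoidDefinitions F.+-rawMonoid using () renaming (_×_ to _·_)

  2≉0 : 1# + 1# ≉ 0#
  2≉0 e = char0 1 (ι-injective (begin
    ι (F.1# F.+ (F.1# F.+ F.0#))  ≈⟨ ι-cong (F.+-congˡ (F.+-identityʳ F.1#)) ⟩
    ι (F.1# F.+ F.1#)             ≈⟨ trans (ι-+ _ _) (+-cong ι-1 ι-1) ⟩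
    1# + 1#                       ≈⟨ trans e (sym ι-0) ⟩
    ι F.0#                        ∎))

  square-root : ∀ a → ∃ λ x → x * x ≈ a
  square-root a = let (x , e) = algebraicallyClosed (- a) (0# ∷ []) in x , (begin
    x * x                                             ≈⟨ solve 2 (λ x a → x :* x := (:- a :+ x :* (:0 :+ x :* (:1 :+ x :* :0))) :+ a) refl x a ⟩
    (- a + x * (0# + x * (1# + x * 0#))) + a          ≈⟨ +-congʳ e ⟩
    0# + a                                            ≈⟨ +-identityˡ a ⟩
    a                                                 ∎)

  IsRoot : List F.Carrier → Carrier → Set ℓ′
  IsRoot as x = eval Ω (map ι (monic F as)) x ≈ 0#

  minimal-polynomial : ∀ x → ∃ λ as → IsMinimalPolynomial as x
  minimal-polynomial x = let (as , root) = algebraic x in descend (length as) as ℕ.≤-refl root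
    where
    -- The bound n on the length makes the descent to a shortest polynomial structural.
    descend : ∀ n as → length as ℕ.≤ n → IsRoot as x → ∃ λ as → IsMinimalPolynomial as x
    descend n as as≤n root with em {P = ∃ λ bs → IsRoot bs x × length bs ℕ.< length as}
    descend n as as≤n root | no ¬smaller = as , record
      { root = root ; minimal = λ bs root′ → ℕ.≮⇒≥ λ bs<as → ¬smaller (bs , root′ , bs<as) }
    descend ℕ.zero    as as≤n root | yes (bs , _ , bs<as) = ⊥-elim (ℕ.n≮0 (ℕ.<-≤-trans bs<as as≤n))
    descend (ℕ.suc n) as as≤n root | yes (bs , root′ , bs<as) =
      descend n bs (ℕ.s≤s⁻¹ (ℕ.<-≤-trans bs<as as≤n)) root′

  -- The coefficients of c (k g + X g′), without the leading one, for g = monic as.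
  scaled-derivative : F.Carrier → ℕ → List F.Carrier → List F.Carrier
  scaled-derivative c k []       = []
  scaled-derivative c k (a ∷ as) = c F.* (k · F.1#) F.* a ∷ scaled-derivative c (ℕ.suc k) as

  length-scaled-derivative : ∀ c k as → length (scaled-derivative c k as) ≡ length as
  length-scaled-derivative c k []       = ≡.refl
  length-scaled-derivative c k (a ∷ as) = ≡.cong ℕ.suc (length-scaled-derivative c (ℕ.suc k) as)

  ι-suc : ∀ k → ι (ℕ.suc k · F.1#) ≈ 1# + ι (k · F.1#)
  ι-suc k = trans (ι-+ _ _) (+-congʳ ι-1)

  -- The factor k grows by one with each coefficient and reaches `k + length as` at the leading one,
  -- where the hypothesis on c makes the result monic.
  eval-scaled-derivative : ∀ c k as x → c F.* ((k ℕ.+ length as) · F.1#) F.≈ F.1# →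
    eval Ω (map ι (monic F (scaled-derivative c k as))) x ≈
    ι c * (ι (k · F.1#) * eval Ω (map ι (monic F as)) x + x * eval′ Ω (map ι (monic F as)) x)
  eval-scaled-derivative c k [] x ck≈1 = begin
    ι F.1# + x * 0#                                             ≈⟨ +-congʳ (ι-cong ck≈1) ⟨
    ι (c F.* ((k ℕ.+ 0) · F.1#)) + x * 0#                       ≡⟨ ≡.cong (λ n → ι (c F.* (n · F.1#)) + x * 0#) (ℕ.+-identityʳ k) ⟩
    ι (c F.* (k · F.1#)) + x * 0#                               ≈⟨ +-congʳ (ι-* _ _) ⟩
    ι c * ι (k · F.1#) + x * 0#                                 ≈⟨ solve 3 (λ c k x → c :* k :+ x :* :0 := c :* (k :* (:1 :+ x :* :0) :+ x :* (:0 :+ x :* :0)))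
                                                                     refl (ι c) (ι (k · F.1#)) x ⟩
    ι c * (ι (k · F.1#) * (1# + x * 0#) + x * (0# + x * 0#))    ≈⟨ *-congˡ (+-congʳ (*-congˡ (+-congʳ ι-1))) ⟨
    ι c * (ι (k · F.1#) * (ι F.1# + x * 0#) + x * (0# + x * 0#)) ∎
  eval-scaled-derivative c k (a ∷ as) x ck≈1 = begin
    ι (c F.* (k · F.1#) F.* a) + x * eval Ω (map ι (monic F (scaled-derivative c (ℕ.suc k) as))) x
      ≈⟨ +-cong (trans (ι-* _ _) (*-congʳ (ι-* _ _))) (*-congˡ (eval-scaled-derivative c (ℕ.suc k) as x
           (F.trans (F.*-congˡ (F.reflexive (≡.cong (_· F.1#) (≡.sym (ℕ.+-suc k (length as)))))) ck≈1))) ⟩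
    ι c * ι (k · F.1#) * ι a + x * (ι c * (ι (ℕ.suc k · F.1#) * e + x * e′))
      ≈⟨ +-congˡ (*-congˡ (*-congˡ (+-congʳ (*-congʳ (ι-suc k))))) ⟩
    ι c * ι (k · F.1#) * ι a + x * (ι c * ((1# + ι (k · F.1#)) * e + x * e′))
      ≈⟨ solve 6 (λ c k a x e e′ → c :* k :* a :+ x :* (c :* ((:1 :+ k) :* e :+ x :* e′))
                                   := c :* (k :* (a :+ x :* e) :+ x :* (e :+ x :* e′))) refl (ι c) (ι (k · F.1#)) (ι a) x e e′ ⟩
    ι c * (ι (k · F.1#) * (ι a + x * e) + x * (e + x * e′)) ∎
    where
    e  = eval Ω (map ι (monic F as)) x
    e′ = eval′ Ω (map ι (monic F as)) x

  -- In characteristic zero the derivative can be divided by the degree. The result is monic of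
  -- smaller degree, so its vanishing at x would contradict minimality. The empty list stands for
  -- the constant 1, which has no root.
  minimal-polynomial-separable : ∀ as x → IsMinimalPolynomial as x → eval′ Ω (map ι (monic F as)) x ≉ 0#
  minimal-polynomial-separable [] x min e =
    1≉0 (trans (trans (sym ι-1) (trans (sym (+-identityʳ _)) (+-congˡ (sym (zeroʳ x))))) (IsMinimalPolynomial.root min))
  minimal-polynomial-separable (a ∷ as) x min e≈0 =
    ℕ.1+n≰n (≡.subst (ℕ.suc (length as) ℕ.≤_) (length-scaled-derivative n⁻¹ 1 as) (IsMinimalPolynomial.minimal min (scaled-derivative n⁻¹ 1 as) root′))
    where
    open Algebra.Definitions F._≈_ using (Invertible)
    inv : Invertible F.1# F._*_ (ℕ.suc (length as) · F.1#)
    inv = F.invertible (char0 (length as))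
    n⁻¹ = proj₁ inv
    e  = eval Ω (map ι (monic F as)) x
    e′ = eval′ Ω (map ι (monic F as)) x

    root′ : IsRoot (scaled-derivative n⁻¹ 1 as) x
    root′ = begin
      eval Ω (map ι (monic F (scaled-derivative n⁻¹ 1 as))) x  ≈⟨ eval-scaled-derivative n⁻¹ 1 as x (proj₁ (proj₂ inv)) ⟩
      ι n⁻¹ * (ι (1 · F.1#) * e + x * e′)                      ≈⟨ *-congˡ (+-congʳ (*-congʳ (trans (ι-cong (F.+-identityʳ _)) ι-1))) ⟩
      ι n⁻¹ * (1# * e + x * e′)                                ≈⟨ *-congˡ (+-congʳ (*-identityˡ e)) ⟩
      ι n⁻¹ * (e + x * e′)                                     ≈⟨ *-congˡ e≈0 ⟩
      ι n⁻¹ * 0#                                               ≈⟨ zeroʳ _ ⟩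
      0#                                                      ∎

  separable : ∀ {p : Level} (K : Subfield Ω p) → IsSeparable K
  separable K {x} _ = let (as , min) = minimal-polynomial x in as , min , minimal-polynomial-separable as x min

-- Extension of embeddings

module Extension {c ℓ c′ ℓ′ : Level} (em : ∀ {a : Level} → ExcludedMiddle a)
                 (zorn : ∀ {a b d p : Level} → ZornsLemma a b d p)
                 {F : Field c ℓ} (char0 : CharacteristicZero F) (closure : AlgebraicClosure F c′ ℓ′) where
  open GaloisTheory closure
  open Field Ω
  open FieldProperties Ω em
  open Closure em char0 closure
  open Relation.Binary.Reasoning.Setoid setoid

  -- The graph of an embedding over F of a subfield of Ω into Ω.
  record IsPartialEmbedding {r : Level} (R : Carrier → Carrier → Set r) : Set (c ⊔ c′ ⊔ ℓ′ ⊔ r) where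
    field
      respects       : ∀ {x x′ y y′} → x ≈ x′ → y ≈ y′ → R x y → R x′ y′
      base       : ∀ a → R (ι a) (ι a)
      plus       : ∀ {x x′ y y′} → R x y → R x′ y′ → R (x + x′) (y + y′)
      times      : ∀ {x x′ y y′} → R x y → R x′ y′ → R (x * x′) (y * y′)
      neg        : ∀ {x y} → R x y → R (- x) (- y)
      inv        : ∀ {x x′ y} → R x y → x * x′ ≈ 1# → ∃ λ y′ → R x′ y′
      -- With additivity, single-valuedness at zero implies it everywhere.
      functional : ∀ {x y} → R x y → x ≈ 0# → y ≈ 0#

    zero′ : R 0# 0#
    zero′ = respects ι-0 ι-0 (base _)

    one : R 1# 1#
    one = respects ι-1 ι-1 (base _)

    unique : ∀ {x y y′} → R x y → R x y′ → y ≈ y′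
    unique r r′ = x-y≈0⇒x≈y (functional (plus r (neg r′)) (-‿inverseʳ _))

    inverse-unique : ∀ {x x′ y y′} → R x y → R x′ y′ → x * x′ ≈ 1# → y * y′ ≈ 1#
    inverse-unique r r′ e = unique (times r r′) (respects (sym e) refl one)

    injective : ∀ {x y} → R x y → y ≈ 0# → x ≈ 0#
    injective {x} {y} r y≈0 with em {P = x ≈ 0#}
    ... | yes x≈0 = x≈0
    ... | no  x≉0 = let (x′ , e) = inverse x≉0 ; (y′ , r′) = inv r e in
      ⊥-elim (1≉0 (trans (sym (inverse-unique r r′ e)) (trans (*-congʳ y≈0) (zeroˡ y′))))

    Domain : Carrier → Set _
    Domain x = ∃ (R x)

  -- Converts each result on images into one on preimages, from which surjectivity is obtained.
  converse : ∀ {r : Level} {R : Carrier → Carrier → Set r} → IsPartialEmbedding R → IsPartialEmbedding (λ y x → R x y)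
  converse isPE = record
    { respects   = λ e e′ → respects e′ e
    ; base       = base
    ; plus       = plus
    ; times      = times
    ; neg        = neg
    ; inv        = λ {y} {y′} r e →
        let (x′ , x*x′≈1) = inverse λ x≈0 → 1≉0 (trans (sym e) (trans (*-congʳ (functional r x≈0)) (zeroˡ y′)))
            (y″ , r′)     = inv r x*x′≈1
        in x′ , respects refl (*-cancelˡ (λ y≈0 → 1≉0 (trans (sym e) (trans (*-congʳ y≈0) (zeroˡ y′))))
                                  (trans (inverse-unique r r′ x*x′≈1) (sym e))) r′
    ; functional = injective
    }
    where open IsPartialEmbedding isPE

  module _ {r : Level} {R : Carrier → Carrier → Set r} (isPE : IsPartialEmbedding R) where
    open IsPartialEmbedding isPE

    map-generated : ∀ {s n : Level} {S : Carrier → Set s} (N : Subfield Ω n) →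
      (∀ {x} → S x → ∃ λ y → R x y × Subfield.Member N y) →
      ∀ {x} → Generated Ω S x → ∃ λ y → R x y × Subfield.Member N y
    map-generated {S = S} N onS = go
      where
      module N = Subfield N
      go : ∀ {x} → Generated Ω S x → ∃ λ y → R x y × N.Member y
      go (gen s)       = onS s
      go (resp e g)    = let (y , r , m) = go g in y , respects e refl r , m
      go 0∈            = 0# , zero′ , N.0∈
      go 1∈            = 1# , one , N.1∈
      go (+∈ g h)      = let (y , r , m) = go g ; (y′ , r′ , m′) = go h in y + y′ , plus r r′ , N.+∈ m m′
      go (*∈ g h)      = let (y , r , m) = go g ; (y′ , r′ , m′) = go h in y * y′ , times r r′ , N.*∈ m m′
      go (-∈ g)        = let (y , r , m) = go g in - y , neg r , N.-∈ m
      go (⁻¹∈ g e)     = let (y , r , m) = go g ; (y′ , r′) = inv r e in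
                         y′ , r′ , N.⁻¹∈ m (inverse-unique r r′ e)

    square-root-conjugate : ∀ a {x y} → x * x ≈ ι a → R x y → y ≈ x ⊎ y ≈ - x
    square-root-conjugate a e r = x²≈y²⇒x≈±y (trans (unique (times r r) (respects (sym e) refl (base a))) (sym e))

    module _ (roots : ∀ {a x} → x * x ≈ ι a → Domain x) where

      F⁽²⁾-image : ∀ {x} → Subfield.Member F⁽²⁾ x → ∃ λ y → R x y × Subfield.Member F⁽²⁾ y
      F⁽²⁾-image = map-generated F⁽²⁾ λ where
        (inj₁ (a , e))     → _ , respects (sym e) refl (base a) , gen (inj₁ (a , refl))
        (inj₂ (a , a≉0 , e)) → let (y , r) = roots e in
          y , r , gen (inj₂ (a , a≉0 , unique (times r r) (respects (sym e) refl (base a))))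

  -- A square root y of an element of F is sent to y or - y, so y is itself the image of one of the
  -- two. Hence the converse relation is also defined at all these roots.
  F⁽²⁾-preimage : ∀ {r : Level} {R : Carrier → Carrier → Set r} (isPE : IsPartialEmbedding R) →
    (∀ {a x} → x * x ≈ ι a → ∃ (R x)) → ∀ {y} → Subfield.Member F⁽²⁾ y → ∃ λ x → R x y × Subfield.Member F⁽²⁾ x
  F⁽²⁾-preimage isPE roots = F⁽²⁾-image (converse isPE) λ {a} {y} e → let (z , r) = roots e in
    [ (λ z≈y → y , respects refl z≈y r)
    , (λ z≈-y → - y , respects refl (trans (-‿cong z≈-y) (-‿involutive y)) (neg r))
    ]′ (square-root-conjugate isPE a e r)
    where open IsPartialEmbedding isPE

  ⟪_⟫ : ∀ {r : Level} → (Carrier → Carrier → Set r) → Carrier → Carrier → Bool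
  ⟪ R ⟫ x y = ⌊ em {P = R x y} ⌋

  ⟪⟫-isPartialEmbedding : ∀ {r : Level} {R : Carrier → Carrier → Set r} →
    IsPartialEmbedding R → IsPartialEmbedding (λ x y → T (⟪ R ⟫ x y))
  ⟪⟫-isPartialEmbedding isPE = record
    { respects       = λ e e′ r → fromWitness (respects e e′ (toWitness r))
    ; base       = λ a → fromWitness (base a)
    ; plus       = λ r r′ → fromWitness (plus (toWitness r) (toWitness r′))
    ; times      = λ r r′ → fromWitness (times (toWitness r) (toWitness r′))
    ; neg        = λ r → fromWitness (neg (toWitness r))
    ; inv        = λ r e → let (y′ , r′) = inv (toWitness r) e in y′ , fromWitness r′
    ; functional = λ r → functional (toWitness r)
    }
    where open IsPartialEmbedding isPE

  -- A graph may leave x₀ outside its domain; it only must not fix it. The inclusion of F qualifies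
  -- because x₀ is not in F. The domain of a maximal graph turns out to be closed under square
  -- roots, so it contains F⁽³⁾, and an x₀ in F⁽³⁾ is then really moved.
  module Moving (x₀ : Carrier) (x₀∉F : ¬ Base x₀) where

    -- The relation is Boolean so that unions of chains do not raise the level.
    record Graph : Set (c ⊔ c′ ⊔ ℓ′) where
      field
        graph              : Carrier → Carrier → Bool
        isPartialEmbedding : IsPartialEmbedding (λ x y → T (graph x y))
        moves              : ¬ T (graph x₀ x₀)
      open IsPartialEmbedding isPartialEmbedding public

    open Graph

    _∋_,_ : Graph → Carrier → Carrier → Set
    G ∋ x , y = T (graph G x y)

    infix 4 _⊑_
    _⊑_ : Graph → Graph → Set c′
    G ⊑ H = ∀ {x y} → G ∋ x , y → H ∋ x , y

    poset : Poset (c ⊔ c′ ⊔ ℓ′) c′ c′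
    poset = record
      { Carrier = Graph
      ; _≈_     = λ G H → G ⊑ H × H ⊑ G
      ; _≤_     = _⊑_
      ; isPartialOrder = record
        { isPreorder = record
          { isEquivalence = record
            { refl  = (λ r → r) , (λ r → r)
            ; sym   = λ (p , q) → q , p
            ; trans = λ (p , q) (p′ , q′) → (λ r → p′ (p r)) , (λ r → q (q′ r))
            }
          ; reflexive = proj₁
          ; trans     = λ p q r → q (p r)
          }
        ; antisym = λ p q → p , q
        }
      }

    fromRelation : ∀ {r : Level} (R : Carrier → Carrier → Set r) → IsPartialEmbedding R → ¬ R x₀ x₀ → Graph
    fromRelation R isPE moves = record
      { graph              = ⟪ R ⟫
      ; isPartialEmbedding = ⟪⟫-isPartialEmbedding isPE
      ; moves              = λ r → moves (toWitness r)
      }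

    baseGraph : Graph
    baseGraph = fromRelation (λ x y → Base x × x ≈ y) (record
      { respects       = λ e e′ ((a , x≈a) , x≈y) → (a , trans (sym e) x≈a) , trans (sym e) (trans x≈y e′)
      ; base       = λ a → (a , refl) , refl
      ; plus       = λ ((a , p) , q) ((b , p′) , q′) → (_ , trans (+-cong p p′) (sym (ι-+ a b))) , +-cong q q′
      ; times      = λ ((a , p) , q) ((b , p′) , q′) → (_ , trans (*-cong p p′) (sym (ι-* a b))) , *-cong q q′
      ; neg        = λ ((a , p) , q) → (_ , trans (-‿cong p) (sym (ι-neg a))) , -‿cong q
      ; inv        = λ {x} {x′} ((a , p) , _) e → x′ , Base-inverse a p e , refl
      ; functional = λ (_ , x≈y) x≈0 → trans (sym x≈y) x≈0
      }) λ (x₀∈F , _) → x₀∉F x₀∈F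
      where
      Base-inverse : ∀ {x x′} a → x ≈ ι a → x * x′ ≈ 1# → Base x′
      Base-inverse {x} {x′} a x≈a e = b , *-cancelˡ x≉0 (trans e (sym (begin
        x * ι b             ≈⟨ *-congʳ x≈a ⟩
        ι a * ι b           ≈⟨ ι-* a b ⟨
        ι (a F.* b)         ≈⟨ trans (ι-cong (proj₂ (proj₂ ainv))) ι-1 ⟩
        1#                  ∎)))
        where
        x≉0 : x ≉ 0#
        x≉0 x≈0 = 1≉0 (trans (sym e) (trans (*-congʳ x≈0) (zeroˡ x′)))
        ainv = F.invertible (λ a≈0 → x≉0 (trans x≈a (trans (ι-cong a≈0) ι-0)))
        b = proj₁ ainv

    module _ (C : Graph → Set) (chain : IsChain poset C) where

      Union : Carrier → Carrier → Set _
      Union x y = ∃ λ G → C G × G ∋ x , y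

      upper : ∀ {G H x y x′ y′} → C G → C H → G ∋ x , y → H ∋ x′ , y′ → ∃ λ K → C K × K ∋ x , y × K ∋ x′ , y′
      upper {G} {H} CG CH r r′ with chain CG CH
      ... | inj₁ G⊑H = H , CH , G⊑H r , r′
      ... | inj₂ H⊑G = G , CG , r , H⊑G r′

      union : ∀ G → C G → Graph
      union G CG = fromRelation Union (record
        { respects       = λ e e′ (G , CG , r) → G , CG , respects G e e′ r
        ; base       = λ a → G , CG , base G a
        ; plus       = λ (G , CG , r) (H , CH , r′) → let (K , CK , s , s′) = upper CG CH r r′ in K , CK , plus K s s′
        ; times      = λ (G , CG , r) (H , CH , r′) → let (K , CK , s , s′) = upper CG CH r r′ in K , CK , times K s s′
        ; neg        = λ (G , CG , r) → G , CG , neg G r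
        ; inv        = λ (G , CG , r) e → let (y′ , r′) = inv G r e in y′ , G , CG , r′
        ; functional = λ (G , _ , r) → functional G r
        }) λ (G , _ , r) → moves G r

      -- The union of an empty chain would not even contain F, so `baseGraph` serves as its bound.
      chain-bound : ∃ λ U → ∀ {G} → C G → G ⊑ U
      chain-bound with em {P = ∃ C}
      ... | yes (G , CG) = union G CG , λ CG r → fromWitness (_ , CG , r)
      ... | no  empty    = baseGraph , λ CG → ⊥-elim (empty (_ , CG))

    maximal : ∃ λ M → ∀ {G} → M ⊑ G → G ⊑ M
    maximal = let (M , max) = zorn poset chain-bound in M , λ {G} M⊑G → proj₂ (max {G} M⊑G)

    -- The extension of an embedding from D to D(α), α² = γ ∈ D, with α ↦ β.
    module Adjoin (G : Graph) {γ δ α β : Carrier} (γδ : G ∋ γ , δ) (α² : α * α ≈ γ) (β² : β * β ≈ δ)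
                  (α∉D : ¬ Domain G α) where

      combination-zero : ∀ {u v u′ v′} → G ∋ u , u′ → G ∋ v , v′ → u + v * α ≈ 0# → u ≈ 0# × v ≈ 0#
      combination-zero {u} {v} r s e with em {P = v ≈ 0#}
      ... | yes v≈0 = trans (trans (sym (+-identityʳ u)) (+-congˡ (trans (sym (zeroˡ α)) (*-congʳ (sym v≈0))))) e , v≈0
      ... | no  v≉0 = let (w , vw≈1) = inverse v≉0 ; (_ , t) = inv G s vw≈1 in
        ⊥-elim (α∉D (_ , respects G (begin
          - u * w               ≈⟨ solve 3 (λ u w va → :- u :* w := (va :- (u :+ va)) :* w) refl u w (v * α) ⟩
          (v * α - (u + v * α)) * w ≈⟨ *-congʳ (trans (+-congˡ (trans (-‿cong e) -0#≈0#)) (+-identityʳ _)) ⟩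
          v * α * w             ≈⟨ solve 3 (λ v α w → v :* α :* w := (v :* w) :* α) refl v α w ⟩
          v * w * α             ≈⟨ trans (*-congʳ vw≈1) (*-identityˡ α) ⟩
          α                     ∎) refl (times G (neg G r) t)))

      -- The norm factors as (u + vα)(u - vα), and a vanishing conjugate would force u = v = 0. Its
      -- inverse yields reciprocals in the extension.
      norm≉0 : ∀ {u v u′ v′} → G ∋ u , u′ → G ∋ v , v′ → u + v * α ≉ 0# → u * u - v * v * γ ≉ 0#
      norm≉0 {u} {v} r s x≉0 e = [ (λ z → x≉0 z) , (λ z → x≉0 (conj z)) ]′ (x*y≈0⇒x≈0∨y≈0 (begin
          (u + v * α) * (u + - v * α)  ≈⟨ solve 3 (λ u v α → (u :+ v :* α) :* (u :+ :- v :* α) := u :* u :- v :* v :* (α :* α)) refl u v α ⟩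
          u * u - v * v * (α * α)      ≈⟨ +-congˡ (-‿cong (*-congˡ α²)) ⟩
          u * u - v * v * γ            ≈⟨ e ⟩
          0#                           ∎))
        where
        conj : u + - v * α ≈ 0# → u + v * α ≈ 0#
        conj z = let (u≈0 , -v≈0) = combination-zero r (neg G s) z in begin
          u + v * α        ≈⟨ solve 3 (λ u v α → u :+ v :* α := u :+ :- (:- v) :* α) refl u v α ⟩
          u + - - v * α    ≈⟨ +-cong u≈0 (*-congʳ (trans (-‿cong -v≈0) -0#≈0#)) ⟩
          0# + 0# * α      ≈⟨ trans (+-identityˡ _) (zeroˡ α) ⟩
          0#               ∎

      Adjoined : Carrier → Carrier → Set _
      Adjoined x y = ∃ λ u → ∃ λ u′ → ∃ λ v → ∃ λ v′ →
        G ∋ u , u′ × G ∋ v , v′ × x ≈ u + v * α × y ≈ u′ + v′ * β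

      isPartialEmbedding-Adjoined : IsPartialEmbedding Adjoined
      isPartialEmbedding-Adjoined = record
        { respects       = λ e e′ (u , u′ , v , v′ , r , s , p , q) → u , u′ , v , v′ , r , s , trans (sym e) p , trans (sym e′) q
        ; base       = λ a → _ , _ , _ , _ , base G a , zero′ G , constant _ α , constant _ β
        ; plus       = λ (u₁ , u₁′ , v₁ , v₁′ , r₁ , s₁ , p₁ , q₁) (u₂ , u₂′ , v₂ , v₂′ , r₂ , s₂ , p₂ , q₂) →
            _ , _ , _ , _ , plus G r₁ r₂ , plus G s₁ s₂ ,
            trans (+-cong p₁ p₂) (sum u₁ v₁ u₂ v₂ α) , trans (+-cong q₁ q₂) (sum u₁′ v₁′ u₂′ v₂′ β)
        ; times      = λ (u₁ , u₁′ , v₁ , v₁′ , r₁ , s₁ , p₁ , q₁) (u₂ , u₂′ , v₂ , v₂′ , r₂ , s₂ , p₂ , q₂) →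
            _ , _ , _ , _ , plus G (times G r₁ r₂) (times G (times G s₁ s₂) γδ) , plus G (times G r₁ s₂) (times G s₁ r₂) ,
            trans (*-cong p₁ p₂) (mult u₁ v₁ u₂ v₂ α²) , trans (*-cong q₁ q₂) (mult u₁′ v₁′ u₂′ v₂′ β²)
        ; neg        = λ (u , u′ , v , v′ , r , s , p , q) → _ , _ , _ , _ , neg G r , neg G s ,
            trans (-‿cong p) (minus u v α) , trans (-‿cong q) (minus u′ v′ β)
        ; inv        = λ (u , u′ , v , v′ , r , s , p , q) e →
            let (n , Nn≈1) = inverse (norm≉0 r s λ z → 1≉0 (trans (sym e) (trans (*-congʳ (trans p z)) (zeroˡ _))))
                (n′ , t)   = inv G (plus G (times G r r) (neg G (times G (times G s s) γδ))) Nn≈1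
            in _ , _ , _ , _ , _ , times G r t , times G (neg G s) t , reciprocal p Nn≈1 e , refl
        ; functional = λ (u , u′ , v , v′ , r , s , p , q) x≈0 →
            let (u≈0 , v≈0) = combination-zero r s (trans (sym p) x≈0) in
            trans q (trans (+-cong (functional G r u≈0) (*-congʳ (functional G s v≈0))) (trans (+-identityˡ _) (zeroˡ β)))
        }
        where
        constant : ∀ u α → u ≈ u + 0# * α
        constant = solve 2 (λ u α → u := u :+ :0 :* α) refl
        sum : ∀ u₁ v₁ u₂ v₂ α → (u₁ + v₁ * α) + (u₂ + v₂ * α) ≈ (u₁ + u₂) + (v₁ + v₂) * α
        sum = solve 5 (λ u₁ v₁ u₂ v₂ α → (u₁ :+ v₁ :* α) :+ (u₂ :+ v₂ :* α) := (u₁ :+ u₂) :+ (v₁ :+ v₂) :* α) refl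
        minus : ∀ u v α → - (u + v * α) ≈ - u + - v * α
        minus = solve 3 (λ u v α → :- (u :+ v :* α) := :- u :+ :- v :* α) refl
        mult : ∀ u₁ v₁ u₂ v₂ {α γ} → α * α ≈ γ →
               (u₁ + v₁ * α) * (u₂ + v₂ * α) ≈ (u₁ * u₂ + v₁ * v₂ * γ) + (u₁ * v₂ + v₁ * u₂) * α
        mult u₁ v₁ u₂ v₂ {α} {γ} e = trans
          (solve 5 (λ u₁ v₁ u₂ v₂ α → (u₁ :+ v₁ :* α) :* (u₂ :+ v₂ :* α)
                     := (u₁ :* u₂ :+ v₁ :* v₂ :* (α :* α)) :+ (u₁ :* v₂ :+ v₁ :* u₂) :* α) refl u₁ v₁ u₂ v₂ α)
          (+-congʳ (+-congˡ (*-congˡ e)))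
        reciprocal : ∀ {x x′ u v n} → x ≈ u + v * α → (u * u - v * v * γ) * n ≈ 1# → x * x′ ≈ 1# → x′ ≈ u * n + - v * n * α
        reciprocal {x} {x′} {u} {v} {n} p Nn≈1 e = begin
          x′                                            ≈⟨ *-identityˡ x′ ⟨
          1# * x′                                       ≈⟨ *-congʳ (trans (*-congʳ (+-congˡ (-‿cong (*-congˡ α²)))) Nn≈1) ⟨
          (u * u - v * v * (α * α)) * n * x′            ≈⟨ solve 5 (λ u v α n x′ → (u :* u :- v :* v :* (α :* α)) :* n :* x′
                                                             := (u :* n :+ :- v :* n :* α) :* ((u :+ v :* α) :* x′)) refl u v α n x′ ⟩
          (u * n + - v * n * α) * ((u + v * α) * x′)    ≈⟨ *-congˡ (trans (*-congʳ (sym p)) e) ⟩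
          (u * n + - v * n * α) * 1#                    ≈⟨ *-identityʳ _ ⟩
          u * n + - v * n * α                           ∎

      extends : ∀ {x y} → G ∋ x , y → Adjoined x y
      extends r = _ , _ , _ , _ , r , zero′ G , solve 2 (λ u α → u := u :+ :0 :* α) refl _ α ,
                  solve 2 (λ u α → u := u :+ :0 :* α) refl _ β

      adjoined : Adjoined α β
      adjoined = _ , _ , _ , _ , zero′ G , one G , solve 1 (λ α → α := :0 :+ :1 :* α) refl α ,
                 solve 1 (λ α → α := :0 :+ :1 :* α) refl β

    M : Graph
    M = proj₁ maximal

    -- If neither α ↦ β nor α ↦ - β could be adjoined, then both extensions would fix x₀;
    -- this forces x₀ into the domain already, and M to fix it.
    square-root-closed : ∀ {γ δ α} → M ∋ γ , δ → α * α ≈ γ → Domain M α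
    square-root-closed {γ} {δ} {α} γδ α² with em {P = Domain M α}
    ... | yes α∈D = α∈D
    ... | no  α∉D = ⊥-elim (both-fix fixed⁺ fixed⁻)
      where
      β = proj₁ (square-root δ)
      β² : β * β ≈ δ
      β² = proj₂ (square-root δ)
      module A⁺ = Adjoin M γδ α² β² α∉D
      module A⁻ = Adjoin M γδ α² (trans (solve 1 (λ b → :- b :* :- b := b :* b) refl β) β²) α∉D

      fixed⁺ : A⁺.Adjoined x₀ x₀
      fixed⁺ with em {P = A⁺.Adjoined x₀ x₀}
      ... | yes r = r
      ... | no ¬r = ⊥-elim (α∉D (β , proj₂ maximal
                      {fromRelation A⁺.Adjoined A⁺.isPartialEmbedding-Adjoined ¬r}
                      (λ r → fromWitness (A⁺.extends r)) (fromWitness A⁺.adjoined)))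

      fixed⁻ : A⁻.Adjoined x₀ x₀
      fixed⁻ with em {P = A⁻.Adjoined x₀ x₀}
      ... | yes r = r
      ... | no ¬r = ⊥-elim (α∉D (- β , proj₂ maximal
                      {fromRelation A⁻.Adjoined A⁻.isPartialEmbedding-Adjoined ¬r}
                      (λ r → fromWitness (A⁻.extends r)) (fromWitness A⁻.adjoined)))

      both-fix : A⁺.Adjoined x₀ x₀ → A⁻.Adjoined x₀ x₀ → ⊥
      both-fix (u₁ , u₁′ , v₁ , v₁′ , r₁ , s₁ , p₁ , q₁) (u₂ , u₂′ , v₂ , v₂′ , r₂ , s₂ , p₂ , q₂) =
        moves M (respects M (sym x₀≈u₁) (sym x₀≈u₁′) r₁)
        where
        difference : u₁ - u₂ ≈ 0# × v₁ - v₂ ≈ 0#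
        difference = A⁺.combination-zero (plus M r₁ (neg M r₂)) (plus M s₁ (neg M s₂)) (begin
          (u₁ - u₂) + (v₁ - v₂) * α             ≈⟨ solve 5 (λ u₁ u₂ v₁ v₂ α → (u₁ :- u₂) :+ (v₁ :- v₂) :* α
                                                     := (u₁ :+ v₁ :* α) :- (u₂ :+ v₂ :* α)) refl u₁ u₂ v₁ v₂ α ⟩
          (u₁ + v₁ * α) - (u₂ + v₂ * α)         ≈⟨ x≈y⇒x-y≈0 (trans (sym p₁) p₂) ⟩
          0#                                    ∎)
        u₁′≈u₂′ : u₁′ ≈ u₂′
        u₁′≈u₂′ = unique M r₁ (respects M (sym (x-y≈0⇒x≈y (proj₁ difference))) refl r₂)
        v₁′≈v₂′ : v₁′ ≈ v₂′
        v₁′≈v₂′ = unique M s₁ (respects M (sym (x-y≈0⇒x≈y (proj₂ difference))) refl s₂)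
        -- Both representations of x₀ by 1 and α agree, hence so do the images of their
        -- coefficients. One extension sends x₀ to u′ + v′β, the other to u′ - v′β, and both values
        -- are x₀.
        v₁′β≈0 : v₁′ * β ≈ 0#
        v₁′β≈0 = x≈-x⇒x≈0 2≉0 (begin
          v₁′ * β                         ≈⟨ solve 2 (λ u y → y := (u :+ y) :- u) refl u₁′ _ ⟩
          (u₁′ + v₁′ * β) - u₁′           ≈⟨ +-cong (trans (sym q₁) q₂) (-‿cong u₁′≈u₂′) ⟩
          (u₂′ + v₂′ * - β) - u₂′         ≈⟨ solve 3 (λ u v β → (u :+ v :* :- β) :- u := :- (v :* β)) refl u₂′ v₂′ β ⟩
          - (v₂′ * β)                     ≈⟨ -‿cong (*-congʳ v₁′≈v₂′) ⟨
          - (v₁′ * β)                     ∎)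
        β≉0 : β ≉ 0#
        β≉0 β≈0 = α∉D (0# , respects M (sym (x²≈0⇒x≈0 (trans α² (injective M γδ
          (trans (sym β²) (trans (*-congʳ β≈0) (zeroˡ β))))))) refl (zero′ M))
        v₁′≈0 : v₁′ ≈ 0#
        v₁′≈0 = x*y≈0⇒y≈0 β≉0 (trans (*-comm β v₁′) v₁′β≈0)
        x₀≈u₁ : x₀ ≈ u₁
        x₀≈u₁ = trans p₁ (trans (+-congˡ (trans (*-congʳ (injective M s₁ v₁′≈0)) (zeroˡ α))) (+-identityʳ u₁))
        x₀≈u₁′ : x₀ ≈ u₁′
        x₀≈u₁′ = trans q₁ (trans (+-congˡ (trans (*-congʳ v₁′≈0) (zeroˡ β))) (+-identityʳ u₁′))

-- The field F⁽³⁾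

module F⁽³⁾-Properties {c ℓ c′ ℓ′ : Level} (em : ∀ {a : Level} → ExcludedMiddle a)
             (zorn : ∀ {a b d p : Level} → ZornsLemma a b d p)
             {F : Field c ℓ} (char0 : CharacteristicZero F) (closure : AlgebraicClosure F c′ ℓ′) where
  open GaloisTheory closure
  open Field Ω
  open FieldProperties Ω em
  open Closure em char0 closure
  open Extension em zorn char0 closure
  open Relation.Binary.Reasoning.Setoid setoid
  private
    module F₂ = Subfield F⁽²⁾
    module F₃ = Subfield F⁽³⁾

  half : ∃ λ h → (1# + 1#) * h ≈ 1#
  half = inverse 2≉0

  F₂⊆F₃ : ∀ {x} → F₂.Member x → F₃.Member x
  F₂⊆F₃ x∈ = gen (inj₁ x∈)

  Base⊆F₂ : ∀ {x} → Base x → F₂.Member x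
  Base⊆F₂ x∈ = gen (inj₁ x∈)

  √Base⊆F₂ : ∀ {x} a → x * x ≈ ι a → F₂.Member x
  √Base⊆F₂ {x} a e with em {P = a F.≈ F.0#}
  ... | no  a≉0 = gen (inj₂ (a , a≉0 , e))
  ... | yes a≈0 = Generated.resp (sym (x²≈0⇒x≈0 (trans e (trans (ι-cong a≈0) ι-0)))) 0∈

  module _ {p : Level} (K : Subfield Ω p) (degree : IsExtensionOfDegree Ω F⁽²⁾ K 2) where
    private module K = Subfield K
    open IsExtensionOfDegree degree
    open IsBasis isBasis

    -- Multiplication by x has a 2 × 2 matrix in the given basis, with entries a, b, b′, d. The
    -- witnesses are its trace a + d and the discriminant (a - d)² + 4bb′ of its characteristic
    -- polynomial.
    quadratic : ∀ {x} → K.Member x → ∃ λ s → ∃ λ d → F₂.Member s × F₂.Member d × (x + x - s) * (x + x - s) ≈ d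
    quadratic {x} x∈ = a + d , (a - d) * (a - d) + (1# + 1#) * ((1# + 1#) * (b * b′)) ,
      F₂.+∈ a∈ d∈ , F₂.+∈ (F₂.*∈ a-d∈ a-d∈) (F₂.*∈ 2∈ (F₂.*∈ 2∈ (F₂.*∈ b∈ b′∈))) , (begin
        (x + x - (a + d)) * (x + x - (a + d))
          ≈⟨ solve 4 (λ x a d q → (x :+ x :- (a :+ d)) :* (x :+ x :- (a :+ d))
               := (a :- d) :* (a :- d) :+ (:1 :+ :1) :* ((:1 :+ :1) :* ((x :- a) :* (x :- d)))) refl x a d b ⟩
        (a - d) * (a - d) + (1# + 1#) * ((1# + 1#) * ((x - a) * (x - d)))
          ≈⟨ +-congˡ (*-congˡ (*-congˡ characteristic)) ⟩
        (a - d) * (a - d) + (1# + 1#) * ((1# + 1#) * (b * b′)) ∎)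
      where
      e₀ = basis 0F
      e₁ = basis 1F
      row₀ = spanning (K.*∈ x∈ (members 0F))
      row₁ = spanning (K.*∈ x∈ (members 1F))
      a = proj₁ row₀ 0F
      b = proj₁ row₀ 1F
      b′ = proj₁ row₁ 0F
      d = proj₁ row₁ 1F
      a∈ = proj₁ (proj₂ row₀) 0F
      b∈ = proj₁ (proj₂ row₀) 1F
      b′∈ = proj₁ (proj₂ row₁) 0F
      d∈ = proj₁ (proj₂ row₁) 1F
      2∈ = F₂.+∈ F₂.1∈ F₂.1∈
      a-d∈ = F₂.+∈ a∈ (F₂.-∈ d∈)

      e₀≉0 : e₀ ≉ 0#
      e₀≉0 e₀≈0 = 1≉0 (independent coefficients
        (λ { 0F → F₂.1∈ ; 1F → F₂.0∈ })
        (trans (+-congʳ (trans (*-congˡ e₀≈0) (zeroʳ 1#))) (trans (+-identityˡ _) (trans (+-identityʳ _) (zeroˡ _)))) 0F)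
        where
        coefficients : Fin 2 → Carrier
        coefficients 0F = 1#
        coefficients 1F = 0#

      characteristic : (x - a) * (x - d) ≈ b * b′
      characteristic = *-cancelˡ e₀≉0 (begin
        e₀ * ((x - a) * (x - d))
          ≈⟨ solve 4 (λ e₀ x a d → e₀ :* ((x :- a) :* (x :- d)) := (x :- d) :* (x :* e₀ :- a :* e₀)) refl e₀ x a d ⟩
        (x - d) * (x * e₀ - a * e₀)
          ≈⟨ *-congˡ (+-congʳ (proj₂ (proj₂ row₀))) ⟩
        (x - d) * (a * e₀ + (b * e₁ + 0#) - a * e₀)
          ≈⟨ solve 6 (λ e₀ e₁ x a b d → (x :- d) :* (a :* e₀ :+ (b :* e₁ :+ :0) :- a :* e₀)
                := b :* (x :* e₁ :- d :* e₁)) refl e₀ e₁ x a b d ⟩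
        b * (x * e₁ - d * e₁)
          ≈⟨ *-congˡ (+-congʳ (proj₂ (proj₂ row₁))) ⟩
        b * (b′ * e₀ + (d * e₁ + 0#) - d * e₁)
          ≈⟨ solve 5 (λ e₀ e₁ b b′ d → b :* (b′ :* e₀ :+ (d :* e₁ :+ :0) :- d :* e₁) := e₀ :* (b :* b′)) refl e₀ e₁ b b′ d ⟩
        e₀ * (b * b′) ∎)

  module _ {r p : Level} {R : Carrier → Carrier → Set r} (isPE : IsPartialEmbedding R)
           (K : Subfield Ω p) (total : ∀ {x} → Subfield.Member K x → ∃ (R x)) where
    open IsPartialEmbedding isPE

    embedding : Subfield.Element K → Carrier
    embedding (_ , x∈) = proj₁ (total x∈)

    embedding-graph : ∀ x → R (proj₁ x) (embedding x)
    embedding-graph (_ , x∈) = proj₂ (total x∈)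

    embedding-isEmbedding : IsEmbedding K embedding
    embedding-isEmbedding = record
      { isRingHomomorphism = record
        { isSemiringHomomorphism = record
          { isNearSemiringHomomorphism = record
            { +-isMonoidHomomorphism = record
              { isMagmaHomomorphism = record
                { isRelHomomorphism = record
                  { cong = λ {x} {y} e → unique (respects e refl (embedding-graph x)) (embedding-graph y) }
                ; homo = λ x y → unique (embedding-graph _) (plus (embedding-graph x) (embedding-graph y))
                }
              ; ε-homo = unique (embedding-graph _) zero′
              }
            ; *-homo = λ x y → unique (embedding-graph _) (times (embedding-graph x) (embedding-graph y))
            }
          ; 1#-homo = unique (embedding-graph _) one
          }
        ; -‿homo = λ x → unique (embedding-graph _) (neg (embedding-graph x))
        }
      ; fixes-base = λ { x (a , e) → unique (embedding-graph x) (respects (sym e) (sym e) (base a)) }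
      }

  module FixedField (x₀ : Carrier) (x₀∉F : ¬ Base x₀) where
    open Moving x₀ x₀∉F using (M; square-root-closed; module Graph)
    open Graph M

    R : Carrier → Carrier → Set
    R x y = T (graph x y)

    roots : ∀ {a x} → x * x ≈ ι a → Domain x
    roots {a} e = square-root-closed (base a) (sym (sym e))

    -- By `quadratic`, x = (s + √d)/2 with s and d in F⁽²⁾, and the domain contains F⁽²⁾ and is
    -- closed under square roots.
    total-K : ∀ {p : Level} (K : Subfield Ω p) → IsExtensionOfDegree Ω F⁽²⁾ K 2 → ∀ {x} → Subfield.Member K x → Domain x
    total-K K degree {x} x∈ =
      let (s , d , s∈ , d∈ , e) = quadratic K degree x∈
          (s′ , s↦ , _)         = F⁽²⁾-image isPartialEmbedding roots s∈
          (d′ , d↦ , _)         = F⁽²⁾-image isPartialEmbedding roots d∈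
          (y , y↦)              = square-root-closed d↦ e
          (h , 2h≈1)            = half
          (h′ , h↦)             = inv (plus one one) 2h≈1
      in _ , respects (begin
        (x + x - s + s) * h      ≈⟨ solve 3 (λ x s h → (x :+ x :- s :+ s) :* h := (:1 :+ :1) :* h :* x) refl x s h ⟩
        (1# + 1#) * h * x        ≈⟨ trans (*-congʳ 2h≈1) (*-identityˡ x) ⟩
        x                        ∎) refl (times (plus y↦ s↦) h↦)

    -- Normality over F confines the image of each quadratic extension K to K, so the maximal
    -- embedding restricts to F⁽³⁾.
    image : ∀ {x} → F₃.Member x → ∃ λ y → R x y × F₃.Member y
    image = map-generated isPartialEmbedding F⁽³⁾ λ where
      (inj₁ x∈) → let (y , r , y∈) = F⁽²⁾-image isPartialEmbedding roots x∈ in y , r , F₂⊆F₃ y∈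
      (inj₂ (K , degree , galois , x∈)) → let (y , r) = total-K K degree x∈ in y , r ,
        gen (inj₂ (K , degree , galois ,
          proj₁ (IsGalois.isNormal galois _ (embedding-isEmbedding isPartialEmbedding K (total-K K degree))) (_ , x∈)))

    preimage : ∀ {y} → F₃.Member y → ∃ λ x → R x y × F₃.Member x
    preimage = map-generated (converse isPartialEmbedding) F⁽³⁾ λ where
      (inj₁ y∈) → let (x , r , x∈) = F⁽²⁾-preimage isPartialEmbedding roots y∈ in x , r , F₂⊆F₃ x∈
      (inj₂ (K , degree , galois , y∈)) →
        let ((x , x∈) , e) = proj₂ (IsGalois.isNormal galois _ (embedding-isEmbedding isPartialEmbedding K (total-K K degree))) y∈
        in x , respects refl e (proj₂ (total-K K degree x∈)) , gen (inj₂ (K , degree , galois , x∈))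

    private
      τ : F₃.Element → F₃.Element
      τ (_ , x∈) = let (y , _ , y∈) = image x∈ in y , y∈

      τ-graph : ∀ x → R (proj₁ x) (proj₁ (τ x))
      τ-graph (_ , x∈) = proj₁ (proj₂ (image x∈))

    automorphism : Automorphism F⁽³⁾
    automorphism = record
      { ⟦_⟧ = τ
      ; isRingIsomorphism = record
        { isRingMonomorphism = record
          { isRingHomomorphism = record
            { isSemiringHomomorphism = record
              { isNearSemiringHomomorphism = record
                { +-isMonoidHomomorphism = record
                  { isMagmaHomomorphism = record
                    { isRelHomomorphism = record { cong = λ {x} {y} e → unique (respects e refl (τ-graph x)) (τ-graph y) }
                    ; homo = λ x y → unique (τ-graph (_ , F₃.+∈ (proj₂ x) (proj₂ y))) (plus (τ-graph x) (τ-graph y))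
                    }
                  ; ε-homo = unique (τ-graph (_ , F₃.0∈)) zero′
                  }
                ; *-homo = λ x y → unique (τ-graph (_ , F₃.*∈ (proj₂ x) (proj₂ y))) (times (τ-graph x) (τ-graph y))
                }
              ; 1#-homo = unique (τ-graph (_ , F₃.1∈)) one
              }
            ; -‿homo = λ x → unique (τ-graph (_ , F₃.-∈ (proj₂ x))) (neg (τ-graph x))
            }
          ; injective = λ {x} {y} e → IsPartialEmbedding.unique (converse isPartialEmbedding)
                          (respects refl e (τ-graph x)) (τ-graph y)
          }
        ; surjective = λ (y , y∈) → let (x , r , x∈) = preimage y∈ in
            (x , x∈) , λ {z} e → unique (respects e refl (τ-graph z)) r
        }
      ; fixes-base = λ { x (a , e) → unique (τ-graph x) (respects (sym e) (sym e) (base a)) }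
      }

    automorphism-moves : ∀ x₀∈ → ¬ proj₁ (Automorphism.⟦_⟧ automorphism (x₀ , x₀∈)) ≈ x₀
    automorphism-moves x₀∈ e = moves (respects refl e (τ-graph (x₀ , x₀∈)))

  fixed-field : ∀ (x : F₃.Element) → (∀ τ → proj₁ (Automorphism.⟦_⟧ {K = F⁽³⁾} τ x) ≈ proj₁ x) → Base (proj₁ x)
  fixed-field (x , x∈) fixed with em {P = Base x}
  ... | yes x∈F = x∈F
  ... | no  x∉F = ⊥-elim (FixedField.automorphism-moves x x∉F x∈ (fixed (FixedField.automorphism x x∉F)))

  -- Quadratic extensions of F⁽²⁾ from sums of two squares

  module _ {α β γ : Carrier} (a g : F.Carrier) (α² : α * α ≈ ι a) (γ² : γ * γ ≈ ι g) (sum : α * α + β * β ≈ γ * γ) where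

    private
      α∈ : F₂.Member α
      α∈ = √Base⊆F₂ a α²

      γ∈ : F₂.Member γ
      γ∈ = √Base⊆F₂ g γ²

      β∈ : F₂.Member β
      β∈ = √Base⊆F₂ (g F.+ F.- a) (begin
        β * β                   ≈⟨ solve 2 (λ a b → b := (a :+ b) :- a) refl (α * α) (β * β) ⟩
        α * α + β * β - α * α   ≈⟨ +-cong (trans sum γ²) (-‿cong α²) ⟩
        ι g - ι a               ≈⟨ trans (ι-+ _ _) (+-congˡ (ι-neg a)) ⟨
        ι (g F.+ F.- a)         ∎)

    -- An embedding changes at most the signs of α and γ, so it takes γ(γ + α) to itself or to γ(γ -
    -- α). The product of these two is (γβ)², a square in F⁽²⁾. The conjugates of η are therefore
    -- among ± η and ± γβ/η, which is why F⁽²⁾(η) is normal over F.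
    module _ (η : Carrier) (η² : η * η ≈ γ * (γ + α)) (η∉F₂ : ¬ F₂.Member η) where

      private
        η≉0 : η ≉ 0#
        η≉0 η≈0 = η∉F₂ (F₂.resp (sym η≈0) F₂.0∈)

      combination-zero : ∀ {u v} → F₂.Member u → F₂.Member v → u + v * η ≈ 0# → u ≈ 0# × v ≈ 0#
      combination-zero {u} {v} u∈ v∈ e with em {P = v ≈ 0#}
      ... | yes v≈0 = trans (trans (sym (+-identityʳ u)) (+-congˡ (trans (sym (zeroˡ η)) (*-congʳ (sym v≈0))))) e , v≈0
      ... | no  v≉0 = let (w , vw≈1) = inverse v≉0 in
        ⊥-elim (η∉F₂ (F₂.resp (begin
          - u * w                   ≈⟨ solve 3 (λ u w va → :- u :* w := (va :- (u :+ va)) :* w) refl u w (v * η) ⟩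
          (v * η - (u + v * η)) * w ≈⟨ *-congʳ (trans (+-congˡ (trans (-‿cong e) -0#≈0#)) (+-identityʳ _)) ⟩
          v * η * w                 ≈⟨ solve 3 (λ v η w → v :* η :* w := (v :* w) :* η) refl v η w ⟩
          v * w * η                 ≈⟨ trans (*-congʳ vw≈1) (*-identityˡ η) ⟩
          η                         ∎) (F₂.*∈ (F₂.-∈ u∈) (F₂.⁻¹∈ v∈ vw≈1))))

      Member : Carrier → Set _
      Member x = ∃ λ u → ∃ λ v → F₂.Member u × F₂.Member v × x ≈ u + v * η

      private
        N : Carrier → Carrier → Carrier
        N u v = u * u - v * v * (γ * (γ + α))

        N-factors : ∀ u v → (u + v * η) * (u + - v * η) ≈ N u v
        N-factors u v = trans
          (solve 3 (λ u v η → (u :+ v :* η) :* (u :+ :- v :* η) := u :* u :- v :* v :* (η :* η)) refl u v η)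
          (+-congˡ (-‿cong (*-congˡ η²)))

        N∈ : ∀ {u v} → F₂.Member u → F₂.Member v → F₂.Member (N u v)
        N∈ u∈ v∈ = F₂.+∈ (F₂.*∈ u∈ u∈) (F₂.-∈ (F₂.*∈ (F₂.*∈ v∈ v∈) (F₂.*∈ γ∈ (F₂.+∈ γ∈ α∈))))

        N≉0 : ∀ {u v} → F₂.Member u → F₂.Member v → u + v * η ≉ 0# → N u v ≉ 0#
        N≉0 {u} {v} u∈ v∈ x≉0 e = x≉0 (let (u≈0 , -v≈0) = combination-zero u∈ (F₂.-∈ v∈)
                                                             (x*y≈0⇒y≈0 x≉0 (trans (N-factors u v) e)) in begin
          u + v * η        ≈⟨ +-cong u≈0 (*-congʳ (trans (sym (-‿involutive v)) (trans (-‿cong -v≈0) -0#≈0#))) ⟩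
          0# + 0# * η      ≈⟨ trans (+-identityˡ _) (zeroˡ η) ⟩
          0#               ∎)

      F₂⟨η⟩ : Subfield Ω levels
      F₂⟨η⟩ = record
        { Member = Member
        ; resp   = λ e (u , v , u∈ , v∈ , p) → u , v , u∈ , v∈ , trans (sym e) p
        ; 0∈     = _ , _ , F₂.0∈ , F₂.0∈ , constant 0#
        ; 1∈     = _ , _ , F₂.1∈ , F₂.0∈ , constant 1#
        ; +∈     = λ (u₁ , v₁ , u₁∈ , v₁∈ , p₁) (u₂ , v₂ , u₂∈ , v₂∈ , p₂) →
            _ , _ , F₂.+∈ u₁∈ u₂∈ , F₂.+∈ v₁∈ v₂∈ , trans (+-cong p₁ p₂)
              (solve 5 (λ u₁ v₁ u₂ v₂ η → (u₁ :+ v₁ :* η) :+ (u₂ :+ v₂ :* η) := (u₁ :+ u₂) :+ (v₁ :+ v₂) :* η) refl u₁ v₁ u₂ v₂ η)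
        ; *∈     = λ (u₁ , v₁ , u₁∈ , v₁∈ , p₁) (u₂ , v₂ , u₂∈ , v₂∈ , p₂) →
            _ , _ , F₂.+∈ (F₂.*∈ u₁∈ u₂∈) (F₂.*∈ (F₂.*∈ v₁∈ v₂∈) (F₂.*∈ γ∈ (F₂.+∈ γ∈ α∈))) ,
            F₂.+∈ (F₂.*∈ u₁∈ v₂∈) (F₂.*∈ v₁∈ u₂∈) , trans (*-cong p₁ p₂) (trans
              (solve 5 (λ u₁ v₁ u₂ v₂ η → (u₁ :+ v₁ :* η) :* (u₂ :+ v₂ :* η)
                  := (u₁ :* u₂ :+ v₁ :* v₂ :* (η :* η)) :+ (u₁ :* v₂ :+ v₁ :* u₂) :* η) refl u₁ v₁ u₂ v₂ η)
              (+-congʳ (+-congˡ (*-congˡ η²))))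
        ; -∈     = λ (u , v , u∈ , v∈ , p) → _ , _ , F₂.-∈ u∈ , F₂.-∈ v∈ , trans (-‿cong p)
              (solve 3 (λ u v η → :- (u :+ v :* η) := :- u :+ :- v :* η) refl u v η)
        ; ⁻¹∈    = λ {x} {y} (u , v , u∈ , v∈ , p) e →
            let (n , Nn≈1) = inverse (N≉0 u∈ v∈ λ z → 1≉0 (trans (sym e) (trans (*-congʳ (trans p z)) (zeroˡ y))))
                n∈ = F₂.⁻¹∈ (N∈ u∈ v∈) Nn≈1
            in _ , _ , F₂.*∈ u∈ n∈ , F₂.*∈ (F₂.-∈ v∈) n∈ , (begin
              y                                            ≈⟨ *-identityˡ y ⟨
              1# * y                                       ≈⟨ *-congʳ (trans (*-congʳ (N-factors u v)) Nn≈1) ⟨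
              (u + v * η) * (u + - v * η) * n * y          ≈⟨ solve 5 (λ u v η n y → (u :+ v :* η) :* (u :+ :- v :* η) :* n :* y
                                                                := (u :* n :+ :- v :* n :* η) :* ((u :+ v :* η) :* y)) refl u v η n y ⟩
              (u * n + - v * n * η) * ((u + v * η) * y)    ≈⟨ *-congˡ (trans (*-congʳ (sym p)) e) ⟩
              (u * n + - v * n * η) * 1#                   ≈⟨ *-identityʳ _ ⟩
              u * n + - v * n * η                          ∎)
        }
        where
        constant : ∀ u → u ≈ u + 0# * η
        constant u = solve 2 (λ u η → u := u :+ :0 :* η) refl u η

      private module K = Subfield F₂⟨η⟩

      F₂⊆F₂⟨η⟩ : ∀ {x} → F₂.Member x → K.Member x
      F₂⊆F₂⟨η⟩ {x} x∈ = _ , _ , x∈ , F₂.0∈ , solve 2 (λ u η → u := u :+ :0 :* η) refl x η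

      η∈ : K.Member η
      η∈ = _ , _ , F₂.0∈ , F₂.1∈ , solve 1 (λ η → η := :0 :+ :1 :* η) refl η

      F₂⟨η⟩-degree : IsExtensionOfDegree Ω F⁽²⁾ F₂⟨η⟩ 2
      F₂⟨η⟩-degree = record
        { contains = F₂⊆F₂⟨η⟩
        ; basis    = pair 1# η
        ; isBasis  = record
          { members     = λ { 0F → K.1∈ ; 1F → η∈ }
          ; spanning    = λ (u , v , u∈ , v∈ , p) → pair u v , (λ { 0F → u∈ ; 1F → v∈ }) , trans p (sum-pair u v)
          ; independent = λ b b∈ e → let (b₀≈0 , b₁≈0) = combination-zero (b∈ 0F) (b∈ 1F) (trans (sum-pair _ _) e) in
                                     λ { 0F → b₀≈0 ; 1F → b₁≈0 }
          }
        }
        where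
        pair : Carrier → Carrier → Fin 2 → Carrier
        pair x y 0F = x
        pair x y 1F = y
        sum-pair : ∀ u v → u + v * η ≈ u * 1# + (v * η + 0#)
        sum-pair u v = solve 3 (λ u v η → u :+ v :* η := u :* :1 :+ (v :* η :+ :0)) refl u v η

      module Normal (f : K.Element → Carrier) (isEmbedding : IsEmbedding F₂⟨η⟩ f) where
        open IsEmbedding isEmbedding
        open RingMorphisms.IsRingHomomorphism isRingHomomorphism

        R : Carrier → Carrier → Set _
        R x y = ∃ λ x∈ → f (x , x∈) ≈ y

        isPE : IsPartialEmbedding R
        isPE = record
          { respects   = λ e e′ (x∈ , p) → K.resp e x∈ , trans (⟦⟧-cong {_ , K.resp e x∈} {_ , x∈} (sym e)) (trans p e′)
          ; base       = λ b → F₂⊆F₂⟨η⟩ (Base⊆F₂ (b , refl)) , fixes-base _ (b , refl)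
          ; plus       = λ (x∈ , p) (y∈ , q) → K.+∈ x∈ y∈ , trans (+-homo (_ , x∈) (_ , y∈)) (+-cong p q)
          ; times      = λ (x∈ , p) (y∈ , q) → K.*∈ x∈ y∈ , trans (*-homo (_ , x∈) (_ , y∈)) (*-cong p q)
          ; neg        = λ (x∈ , p) → K.-∈ x∈ , trans (-‿homo (_ , x∈)) (-‿cong p)
          ; inv        = λ (x∈ , p) e → _ , K.⁻¹∈ x∈ e , refl
          ; functional = λ (x∈ , p) x≈0 → trans (sym p) (trans (⟦⟧-cong {_ , x∈} {_ , K.0∈} x≈0) 0#-homo)
          }
        open IsPartialEmbedding isPE
        open IsPartialEmbedding (converse isPE) using () renaming (inv to inv⁻¹)

        roots : ∀ {a x} → x * x ≈ ι a → Domain x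
        roots {a} e = _ , F₂⊆F₂⟨η⟩ (√Base⊆F₂ a e) , refl

        η′ : Carrier
        η′ = f (η , η∈)

        η↦ : R η η′
        η↦ = η∈ , refl

        γβ↤ : ∃ λ x → R x (γ * β)
        γβ↤ = let (x , r , _) = F⁽²⁾-preimage isPE roots (F₂.*∈ γ∈ β∈) in x , r

        plus-case : ∀ {α′ γ′} → η′ * η′ ≈ γ′ * (γ′ + α′) → γ′ * (γ′ + α′) ≈ γ * (γ + α) → η′ ≈ η ⊎ η′ ≈ - η
        plus-case e e′ = x²≈y²⇒x≈±y (trans e (trans e′ (sym η²)))

        minus-case : ∀ {α′ γ′} → η′ * η′ ≈ γ′ * (γ′ + α′) → γ′ * (γ′ + α′) ≈ γ * (γ - α) → η * η′ ≈ γ * β ⊎ η * η′ ≈ - (γ * β)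
        minus-case {α′} {γ′} e e′ = x²≈y²⇒x≈±y (begin
          (η * η′) * (η * η′)            ≈⟨ solve 2 (λ x y → (x :* y) :* (x :* y) := (x :* x) :* (y :* y)) refl η η′ ⟩
          (η * η) * (η′ * η′)            ≈⟨ *-cong η² (trans e e′) ⟩
          γ * (γ + α) * (γ * (γ - α))    ≈⟨ solve 2 (λ γ α → γ :* (γ :+ α) :* (γ :* (γ :- α)) := γ :* γ :* (γ :* γ :- α :* α)) refl γ α ⟩
          γ * γ * (γ * γ - α * α)        ≈⟨ *-congˡ (+-congʳ sum) ⟨
          γ * γ * (α * α + β * β - α * α) ≈⟨ solve 3 (λ γ α β → γ :* γ :* (α :* α :+ β :* β :- α :* α) := (γ :* β) :* (γ :* β)) refl γ α β ⟩
          (γ * β) * (γ * β)              ∎)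

        -- Equal signs on α and γ leave γ(γ + α) unchanged and give the first alternative; opposite
        -- signs give the second.
        conjugates : (η′ ≈ η ⊎ η′ ≈ - η) ⊎ (η * η′ ≈ γ * β ⊎ η * η′ ≈ - (γ * β))
        conjugates = cases (square-root-conjugate isPE a α² α↦) (square-root-conjugate isPE g γ² γ↦)
          where
          α′ = f (α , F₂⊆F₂⟨η⟩ α∈)
          γ′ = f (γ , F₂⊆F₂⟨η⟩ γ∈)
          α↦ : R α α′
          α↦ = _ , refl
          γ↦ : R γ γ′
          γ↦ = _ , refl
          η′² : η′ * η′ ≈ γ′ * (γ′ + α′)
          η′² = unique (times η↦ η↦) (respects (sym η²) refl (times γ↦ (plus γ↦ α↦)))
          cases : α′ ≈ α ⊎ α′ ≈ - α → γ′ ≈ γ ⊎ γ′ ≈ - γ → _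
          cases (inj₁ p) (inj₁ q) = inj₁ (plus-case η′² (*-cong q (+-cong q p)))
          cases (inj₁ p) (inj₂ q) = inj₂ (minus-case η′² (trans (*-cong q (+-cong q p))
                                      (solve 2 (λ γ α → :- γ :* (:- γ :+ α) := γ :* (γ :- α)) refl γ α)))
          cases (inj₂ p) (inj₁ q) = inj₂ (minus-case η′² (*-cong q (+-cong q p)))
          cases (inj₂ p) (inj₂ q) = inj₁ (plus-case η′² (trans (*-cong q (+-cong q p))
                                      (solve 2 (λ γ α → :- γ :* (:- γ :+ :- α) := γ :* (γ :+ α)) refl γ α)))

        η⁻¹ = proj₁ (inverse η≉0)
        η′≈ : ∀ {z} → η * η′ ≈ z → z * η⁻¹ ≈ η′
        η′≈ {z} e = begin
          z * η⁻¹          ≈⟨ *-congʳ e ⟨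
          η * η′ * η⁻¹     ≈⟨ solve 3 (λ x y z → x :* y :* z := (x :* z) :* y) refl η η′ η⁻¹ ⟩
          η * η⁻¹ * η′     ≈⟨ trans (*-congʳ (proj₂ (inverse η≉0))) (*-identityˡ η′) ⟩
          η′               ∎

        η⁻¹∈ : K.Member η⁻¹
        η⁻¹∈ = K.⁻¹∈ η∈ (proj₂ (inverse η≉0))

        γβ∈ : K.Member (γ * β)
        γβ∈ = F₂⊆F₂⟨η⟩ (F₂.*∈ γ∈ β∈)

        η′∈ : K.Member η′
        η′∈ = from conjugates
          where
          from : (η′ ≈ η ⊎ η′ ≈ - η) ⊎ (η * η′ ≈ γ * β ⊎ η * η′ ≈ - (γ * β)) → K.Member η′
          from (inj₁ (inj₁ e)) = K.resp (sym e) η∈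
          from (inj₁ (inj₂ e)) = K.resp (sym e) (K.-∈ η∈)
          from (inj₂ (inj₁ e)) = K.resp (η′≈ e) (K.*∈ γβ∈ η⁻¹∈)
          from (inj₂ (inj₂ e)) = K.resp (η′≈ e) (K.*∈ (K.-∈ γβ∈) η⁻¹∈)

        η↤ : ∃ λ x → R x η
        η↤ = from conjugates
          where
          η′≉0 : η′ ≉ 0#
          η′≉0 e = η≉0 (injective η↦ e)
          -- From ηη′ = z follows η = z/η′, and both z and η′ are values of the embedding.
          quotient : ∀ {z x} → R x z → η * η′ ≈ z → ∃ λ x → R x η
          quotient {z} r e = let (n , η′n≈1) = inverse η′≉0 ; (_ , s) = inv⁻¹ η↦ η′n≈1 in
            _ , respects refl (begin
              z * n            ≈⟨ *-congʳ e ⟨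
              η * η′ * n       ≈⟨ *-assoc η η′ n ⟩
              η * (η′ * n)     ≈⟨ trans (*-congˡ η′n≈1) (*-identityʳ η) ⟩
              η                ∎) (times r s)
          from : (η′ ≈ η ⊎ η′ ≈ - η) ⊎ (η * η′ ≈ γ * β ⊎ η * η′ ≈ - (γ * β)) → ∃ λ x → R x η
          from (inj₁ (inj₁ e)) = _ , respects refl e η↦
          from (inj₁ (inj₂ e)) = _ , respects refl (trans (-‿cong e) (-‿involutive η)) (neg η↦)
          from (inj₂ (inj₁ e)) = quotient (proj₂ γβ↤) e
          from (inj₂ (inj₂ e)) = quotient (neg (proj₂ γβ↤)) e

        into : ∀ x → K.Member (f x)
        into (x , x∈@(u , v , u∈ , v∈ , p)) =
          let (u′ , u↦ , u′∈) = F⁽²⁾-image isPE roots u∈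
              (v′ , v↦ , v′∈) = F⁽²⁾-image isPE roots v∈
          in K.resp (unique (respects (sym p) refl (plus u↦ (times v↦ η↦))) (x∈ , refl))
               (K.+∈ (F₂⊆F₂⟨η⟩ u′∈) (K.*∈ (F₂⊆F₂⟨η⟩ v′∈) η′∈))

        onto : ∀ {y} → K.Member y → ∃ λ x → f x ≈ y
        onto (u , v , u∈ , v∈ , p) =
          let (u′ , u↤ , _) = F⁽²⁾-preimage isPE roots u∈
              (v′ , v↤ , _) = F⁽²⁾-preimage isPE roots v∈
              (x∈ , e)      = respects refl (sym p) (plus u↤ (times v↤ (proj₂ η↤)))
          in (_ , x∈) , e

      F₂⟨η⟩-isGalois : IsGalois F₂⟨η⟩
      F₂⟨η⟩-isGalois = record
        { contains    = λ x∈ → F₂⊆F₂⟨η⟩ (Base⊆F₂ x∈)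
        ; isNormal    = λ f emb → Normal.into f emb , Normal.onto f emb
        ; isSeparable = separable F₂⟨η⟩
        }

    √[γ²+γα]∈F₃ : ∃ λ η → F₃.Member η × η * η ≈ γ * (γ + α)
    √[γ²+γα]∈F₃ = let (η , η²) = square-root (γ * (γ + α)) in η , member η η² , η²
      where
      member : ∀ η → η * η ≈ γ * (γ + α) → F₃.Member η
      member η η² with em {P = F₂.Member η}
      ... | yes η∈ = F₂⊆F₃ η∈
      ... | no  η∉ = gen (inj₂ (F₂⟨η⟩ η η² η∉ , F₂⟨η⟩-degree η η² η∉ , F₂⟨η⟩-isGalois η η² η∉ , η∈ η η² η∉))

-- The presented group acting on F⁽³⁾

module _ {c ℓ c′ ℓ′ : Level} (em : ∀ {a : Level} → ExcludedMiddle a)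
         (zorn : ∀ {a b d p : Level} → ZornsLemma a b d p)
         {F : Field c ℓ} (char0 : CharacteristicZero F) (closure : AlgebraicClosure F c′ ℓ′)
         (φ : Word 5 → Group.Carrier (GaloisTheory.W-group closure))
         (φ-iso : GroupMorphisms.IsGroupIsomorphism (Group.rawGroup five-involution-group)
                    (Group.rawGroup (GaloisTheory.W-group closure)) φ) where
  open GaloisTheory closure
  open Field Ω
  open Closure em char0 closure
  open F⁽³⁾-Properties em zorn char0 closure
  private
    module F₃ = Subfield F⁽³⁾
    module φ = GroupMorphisms.IsGroupIsomorphism φ-iso

  F⁽³⁾-field : Field (c′ ⊔ suc levels) ℓ′
  F⁽³⁾-field = record
    { commutativeRing = F₃.subring
    ; 1≉0             = 1≉0
    ; invertible      = λ {x} x≉0 → let (y , yx≈1 , xy≈1) = invertible x≉0 in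
                        (y , F₃.⁻¹∈ (proj₂ x) xy≈1) , yx≈1 , xy≈1
    }

  private module F³ = Field F⁽³⁾-field

  act : Word 5 → F₃.Element → F₃.Element
  act u = Automorphism.⟦_⟧ {K = F⁽³⁾} (φ u)

  -- Every automorphism of F⁽³⁾ over F is given by a word, as φ is surjective, so `fixed-field`
  -- applies.
  invariant⇒Base : ∀ (x : F₃.Element) → (∀ u → proj₁ (act u x) ≈ proj₁ x) → Base (proj₁ x)
  invariant⇒Base x inv = fixed-field x λ τ →
    let (u , φu≈τ) = φ.surjective τ in trans (sym (φu≈τ W.refl x)) (inv u)

  wField : WField (c′ ⊔ suc levels) ℓ′
  wField = record
    { K                  = F⁽³⁾-field
    ; 2≉0                = 2≉0
    ; act                = act
    ; isRingHomomorphism = λ u → Automorphism.isRingHomomorphism {K = F⁽³⁾} (φ u)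
    ; act-≈              = φ.⟦⟧-cong
    ; act-∙              = φ.∙-homo
    ; act-ε              = φ.ε-homo
    ; faithful           = λ u trivial → φ.injective λ x → trans (trivial x) (sym (φ.ε-homo x))
    ; square-root        = λ {x} inv → let (a , x≈a) = invariant⇒Base x inv ; (α , α²) = square-root (proj₁ x) in
                           (α , F₂⊆F₃ (√Base⊆F₂ a (trans α² x≈a))) , α²
    ; √[γ²+γα]           = λ {α} {β} {γ} inv inv′ sum →
        let (a , α²) = invariant⇒Base (α F³.* α) inv
            (g , γ²) = invariant⇒Base (γ F³.* γ) inv′
            (η , η∈ , η²) = √[γ²+γα]∈F₃ a g α² γ² sum
        in (η , η∈) , η²
    }

theorem3p3 : (∀ {a : Level} → ExcludedMiddle a) →
    (∀ {a b d p : Level} → ZornsLemma a b d p) →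
    ∀ {c ℓ c′ ℓ′ : Level} →
    ¬ (∃ λ (F : Field c ℓ) →
    CharacteristicZero F × Pythagorean F × FormallyReal F ×
    ∃ λ (closure : AlgebraicClosure F c′ ℓ′) →
    ∃ λ (φ : Word 5 → Group.Carrier (GaloisTheory.W-group closure)) →
    GroupMorphisms.IsGroupIsomorphism (Group.rawGroup five-involution-group) (Group.rawGroup (GaloisTheory.W-group closure)) φ ×
    IndependentModulo (GaloisTheory.W-group closure) (GaloisTheory.Φ closure) (φ ∘ σ))
theorem3p3 em zorn (F , char0 , _ , _ , closure , φ , φ-iso , _) =
  Impossible.impossible em (wField em zorn char0 closure φ φ-iso)
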